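{- Let $D$ be a defining set for the full design $F(v,3)$. Then $$|D|\geq \frac{v(v-1)\left(v-\frac52-\sqrt{(32v-85)/12}\right)}{6}=\binom{v}{3}\left(1-O(v^{ -1/2})\right).$$
   Context: $N(v)=\{1,\dots,v\}$. A $(v,k,\lambda)$-design is a collection (repeated blocks allowed) of $k$-element subsets (blocks) of $N(v)$ such that each unordered pair of distinct elements of $N(v)$ lies in exactly $\lambda$ blocks. The full design $F(v,k)$ consists of all $k$-subsets of $N(v)$, each once. A subset $D\subseteq F(v,k)$ is a defining set for $F(v,k)$ if $F(v,k)$ is the only $(v,k,\binom{v-2}{k-2})$-design (repeated blocks allowed) containing $D$. $|D|$ is the number of blocks in $D$. -}

module Defs where

open import Data.Nat using (ℕ; _≤_; _∸_)
open import Data.Nat.Combinatorics using (_C_)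
open import Data.Integer as ℤ using (ℤ; +_)
open import Data.Bool using (Bool)
import Data.Bool as Bool
open import Data.Fin using (Fin)
open import Data.Fin.Subset using (Subset; _∈_; ∣_∣)
open import Data.Fin.Subset.Properties using (_∈?_)
open import Data.List using (List; length; filter)
open import Data.List.Relation.Unary.All using (All)
open import Data.List.Relation.Unary.Unique.Propositional using (Unique)
import Data.List.Membership.Propositional as LM
open import Data.Vec.Properties using (≡-dec)
open import Data.Product using (_×_)
open import Data.Sum using (_⊎_)
open import Relation.Nullary using (¬_)
open import Relation.Nullary.Decidable using (_×-dec_)
open import Relation.Binary.PropositionalEquality using (_≡_)

-- N(v) is modelled by Fin v; a block is a subset of Fin v.
-- A collection of blocks (repeats allowed) is a list of subsets.

pairCount : {v : ℕ} → Fin v → Fin v → List (Subset v) → ℕ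
pairCount i j L = length (filter (λ B → (i ∈? B) ×-dec (j ∈? B)) L)

mult : {v : ℕ} → Subset v → List (Subset v) → ℕ
mult B L = length (filter (λ B′ → ≡-dec Bool._≟_ B′ B) L)

IsDesign : (v k lam : ℕ) → List (Subset v) → Set
IsDesign v k lam L =
  All (λ B → ∣ B ∣ ≡ k) L ×
  (∀ (i j : Fin v) → ¬ (i ≡ j) → pairCount i j L ≡ lam)

-- L is (as a multiset) the full design F(v,k): every k-subset occurs exactly once
-- (together with IsDesign, which forces all blocks to be k-subsets)
IsFull : (v k : ℕ) → List (Subset v) → Set
IsFull v k L = ∀ (B : Subset v) → ∣ B ∣ ≡ k → mult B L ≡ 1

IsSubsetOfFull : (v k : ℕ) → List (Subset v) → Set
IsSubsetOfFull v k D = Unique D × All (λ B → ∣ B ∣ ≡ k) D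

IsDefiningSet : (v k : ℕ) → List (Subset v) → Set
IsDefiningSet v k D =
  IsSubsetOfFull v k D ×
  (∀ (L : List (Subset v)) → IsDesign v k ((v ∸ 2) C (k ∸ 2)) L →
     (∀ {B} → B LM.∈ D → B LM.∈ L) → IsFull v k L)

-- x ≤ c · √r  (intended for c ≥ 0, r ≥ 0), expressed without reals:
-- either x ≤ 0, or x² ≤ c² r.
_≤_·√_ : ℤ → ℤ → ℤ → Set
x ≤ c ·√ r = (x ℤ.≤ + 0) ⊎ (x ℤ.* x ℤ.≤ c ℤ.* c ℤ.* r)

{-# OPTIONS --safe #-}

-- Call a triple free if it is not in D. For z ≠ w let H be the graph of pairs xy with zxy and wxy both free.
-- A nonzero g : E(H) → {-1,0,1} with zero sum at every vertex would give the trade (z - w) g, which turns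
-- F(v,3) into a different design still containing D; so no such g exists. In a breadth-first forest of H this
-- forces every non-tree edge to close an odd cycle and these cycles to be vertex disjoint. As z and w are
-- isolated, H has at most (v-3) + (v-2)/3 edges. Summing over all z ≠ w bounds Σ d(xy)(d(xy)-1), where d(xy) is
-- the number of free triples through xy, and the theorem follows by Cauchy-Schwarz.
module Submission where

open import Defs
open import Algebra.Properties.CommutativeSemigroup using (interchange)
import Data.Bool as Bool
open import Data.Empty using (⊥; ⊥-elim)
open import Data.Fin as Fin using (Fin; zero; suc)
open import Data.Fin.Properties as Fin using (_≟_; any?; all?; ¬∀⟶∃¬)
open import Data.Fin.Subset using (Subset; inside; outside; ⁅_⁆; _∪_; ∣_∣) renaming (_∈_ to _∈ˢ_)
open import Data.Fin.Subset.Properties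
  using (_∈?_; x∈⁅x⁆; x∈⁅y⁆⇒x≡y; x∈p∪q⁺; x∈p∪q⁻; ⊆-antisym; drop-there; ∪-comm; ∪-assoc)
open import Data.Integer as ℤ hiding (suc; ∣_∣; _≟_)
open import Data.Integer.Properties hiding (_≟_)
open import Data.Integer.Tactic.RingSolver using (solve-∀)
open import Data.List using (List; []; _∷_; _++_; map; filter; length; allFin; concat; cartesianProduct)
open import Data.List.Membership.Propositional using (_∈_; _∉_)
import Data.List.Membership.DecPropositional as DecMembership
open import Data.List.Membership.Propositional.Properties
open import Data.List.Properties using (length-++; length-map; length-tabulate; map-tabulate; filter-++; filter-none)
open import Data.List.Relation.Binary.Disjoint.Propositional using (Disjoint)
open import Data.List.Relation.Unary.All as All using (All; []; _∷_)
import Data.List.Relation.Unary.All.Properties as All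
open import Data.List.Relation.Unary.AllPairs as AllPairs using (AllPairs; []; _∷_)
import Data.List.Relation.Unary.AllPairs.Properties as AllPairs
open import Data.List.Relation.Unary.Any using (here; there)
open import Data.List.Relation.Unary.Unique.Propositional using (Unique)
import Data.List.Relation.Unary.Unique.Propositional.Properties as Unique
open import Data.Nat as ℕ using (ℕ; zero; suc)
open import Data.Nat.Combinatorics using (_C_; nC1≡n)
import Data.Nat.Properties as ℕ
open import Data.Product as Product using (_×_; _,_; proj₁; proj₂; ∃)
open import Data.Sum using (_⊎_; inj₁; inj₂)
open import Data.Vec using ([]; _∷_; here; there)
import Data.Vec.Properties as Vec
open import Function using (_∘_; id)
open import Relation.Binary.Construct.Closure.ReflexiveTransitive
  using (Star; _◅_; _◅◅_; reverse) renaming (ε to ε⋆)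
open import Relation.Binary.Definitions using (tri<; tri≈; tri>)
open import Relation.Binary.PropositionalEquality
open import Relation.Nullary
open import Relation.Nullary.Decidable using (_×-dec_; _⊎-dec_; ¬?)
open import Relation.Unary using (Decidable)

-- The difference of two cones is forced: one cone over `g` would leave the pair xy unbalanced, and
-- in z - w these contributions cancel. The bound on the values of `g` is the real obstacle. Over
-- the integers any two odd cycles of one component combine to a balanced function, but a path
-- joining disjoint cycles then carries 2 or -2, and a block of `F(v,3)` can be removed only once.
-- So odd cycles may occur, provided that they stay apart. No cycle is ever traced. After
-- multiplication by the sign of the depth, zero sum at a vertex becomes conservation of flow on the
-- forest, and the path from a vertex to its root carries one unit. A non-tree edge inside a level
-- leaves two units at the root, so only the difference of two such edges can balance. Its value is
-- 2 or -2 exactly at a vertex whose subtree contains both ends of one edge and neither end of the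
-- other. Failure to give a trade is thus itself the separation that makes the cycles disjoint.

private variable
  A B X Y : Set

-- Duplicate-free lists

Unique-⊆⇒length-≤ : {xs ys : List A} → Unique xs → (∀ {x} → x ∈ xs → x ∈ ys) → length xs ℕ.≤ length ys
Unique-⊆⇒length-≤ {xs = []} _ _ = ℕ.z≤n
Unique-⊆⇒length-≤ {xs = x ∷ xs} u@(_ ∷ uxs) sub with ∈-∃++ (sub (here refl))
... | ys₁ , ys₂ , refl = begin
  suc (length xs)                  ≤⟨ ℕ.s≤s (Unique-⊆⇒length-≤ uxs sub′) ⟩
  suc (length (ys₁ ++ ys₂))        ≡⟨ cong suc (length-++ ys₁) ⟩
  suc (length ys₁ ℕ.+ length ys₂)  ≡⟨ ℕ.+-suc (length ys₁) (length ys₂) ⟨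
  length ys₁ ℕ.+ suc (length ys₂)  ≡⟨ length-++ ys₁ ⟨
  length (ys₁ ++ x ∷ ys₂)          ∎
  where
  open ℕ.≤-Reasoning
  sub′ : ∀ {y} → y ∈ xs → y ∈ ys₁ ++ ys₂
  sub′ y∈xs with ∈-++⁻ ys₁ (sub (there y∈xs))
  ... | inj₁ y∈ys₁ = ∈-++⁺ˡ y∈ys₁
  ... | inj₂ (here refl) = contradiction y∈xs (Unique.Unique[x∷xs]⇒x∉xs u)
  ... | inj₂ (there y∈ys₂) = ∈-++⁺ʳ ys₁ y∈ys₂

Unique-↔⇒length-≡ : {xs ys : List A} → Unique xs → Unique ys →
  (∀ {x} → x ∈ xs → x ∈ ys) → (∀ {x} → x ∈ ys → x ∈ xs) → length xs ≡ length ys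
Unique-↔⇒length-≡ ux uy f g = ℕ.≤-antisym (Unique-⊆⇒length-≤ ux f) (Unique-⊆⇒length-≤ uy g)

Unique⇒length≤n : ∀ {n} {xs : List (Fin n)} → Unique xs → length xs ℕ.≤ n
Unique⇒length≤n {n} {xs} u = subst (length xs ℕ.≤_) (length-tabulate {n = n} id)
  (Unique-⊆⇒length-≤ u (λ _ → ∈-allFin _))

AllPairs-withAll : {R : A → A → Set} {P : A → Set} {xs : List A} → AllPairs R xs → All P xs →
  AllPairs (λ x y → R x y × P x × P y) xs
AllPairs-withAll [] [] = []
AllPairs-withAll (r ∷ rs) (p ∷ ps) = All.zipWith (λ (r , q) → r , p , q) (r , ps) ∷ AllPairs-withAll rs ps

-- Indicators and finite sums

*-vanishʳ : ∀ x {y} → y ≡ 0ℤ → x * y ≡ 0ℤ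
*-vanishʳ x refl = *-zeroʳ x

ind : Dec X → ℤ
ind (yes _) = 1ℤ
ind (no _)  = 0ℤ

ind-yes : (d : Dec X) → X → ind d ≡ 1ℤ
ind-yes (yes _) _ = refl
ind-yes (no ¬p) p = contradiction p ¬p

ind-no : (d : Dec X) → ¬ X → ind d ≡ 0ℤ
ind-no (yes p) ¬p = contradiction p ¬p
ind-no (no _) _ = refl

ind-cong : (d : Dec X) (e : Dec Y) → (X → Y) → (Y → X) → ind d ≡ ind e
ind-cong (yes _) (yes _) _ _ = refl
ind-cong (yes p) (no ¬q) f _ = contradiction (f p) ¬q
ind-cong (no ¬p) (yes q) _ g = contradiction (g q) ¬p
ind-cong (no _) (no _) _ _ = refl

0≤ind : (d : Dec X) → 0ℤ ≤ ind d
0≤ind (yes _) = +≤+ ℕ.z≤n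
0≤ind (no _) = ≤-refl

ind-idem : (d : Dec X) → ind d * ind d ≡ ind d
ind-idem (yes _) = refl
ind-idem (no _) = refl

∑ : List A → (A → ℤ) → ℤ
∑ [] f = 0ℤ
∑ (x ∷ xs) f = f x + ∑ xs f

∑-cong-∈ : (xs : List A) {f g : A → ℤ} → (∀ x → x ∈ xs → f x ≡ g x) → ∑ xs f ≡ ∑ xs g
∑-cong-∈ [] e = refl
∑-cong-∈ (x ∷ xs) e = cong₂ _+_ (e x (here refl)) (∑-cong-∈ xs (λ y y∈ → e y (there y∈)))

∑-cong : (xs : List A) {f g : A → ℤ} → (∀ x → f x ≡ g x) → ∑ xs f ≡ ∑ xs g
∑-cong xs e = ∑-cong-∈ xs (λ x _ → e x)

∑-mono-∈ : (xs : List A) {f g : A → ℤ} → (∀ x → x ∈ xs → f x ≤ g x) → ∑ xs f ≤ ∑ xs g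
∑-mono-∈ [] e = ≤-refl
∑-mono-∈ (x ∷ xs) e = +-mono-≤ (e x (here refl)) (∑-mono-∈ xs (λ y y∈ → e y (there y∈)))

∑-mono : (xs : List A) {f g : A → ℤ} → (∀ x → f x ≤ g x) → ∑ xs f ≤ ∑ xs g
∑-mono xs e = ∑-mono-∈ xs (λ x _ → e x)

∑-const : (xs : List A) (c : ℤ) → ∑ xs (λ _ → c) ≡ + length xs * c
∑-const [] c = refl
∑-const (x ∷ xs) c = trans (cong (_+_ c) (∑-const xs c)) (sym (suc-* (+ length xs) c))

∑-zero : (xs : List A) → ∑ xs (λ _ → 0ℤ) ≡ 0ℤ
∑-zero xs = trans (∑-const xs 0ℤ) (*-zeroʳ (+ length xs))

∑-+ : (xs : List A) (f g : A → ℤ) → ∑ xs (λ x → f x + g x) ≡ ∑ xs f + ∑ xs g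
∑-+ [] f g = refl
∑-+ (x ∷ xs) f g = trans (cong (_+_ (f x + g x)) (∑-+ xs f g)) (interchange +-commutativeSemigroup (f x) (g x) _ _)

∑-* : (xs : List A) (c : ℤ) (f : A → ℤ) → ∑ xs (λ x → c * f x) ≡ c * ∑ xs f
∑-* [] c f = sym (*-zeroʳ c)
∑-* (x ∷ xs) c f = trans (cong (_+_ (c * f x)) (∑-* xs c f)) (sym (*-distribˡ-+ c (f x) _))

∑-neg : (xs : List A) (f : A → ℤ) → ∑ xs (λ x → - f x) ≡ - ∑ xs f
∑-neg [] f = refl
∑-neg (x ∷ xs) f = trans (cong (_+_ (- f x)) (∑-neg xs f)) (sym (neg-distrib-+ (f x) _))

∑-minus : (xs : List A) (f g : A → ℤ) → ∑ xs (λ x → f x - g x) ≡ ∑ xs f - ∑ xs g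
∑-minus xs f g = trans (∑-+ xs f (λ x → - g x)) (cong (_+_ (∑ xs f)) (∑-neg xs g))

∑-++ : (xs ys : List A) (f : A → ℤ) → ∑ (xs ++ ys) f ≡ ∑ xs f + ∑ ys f
∑-++ [] ys f = sym (+-identityˡ _)
∑-++ (x ∷ xs) ys f = trans (cong (_+_ (f x)) (∑-++ xs ys f)) (sym (+-assoc (f x) _ _))

∑-map : (h : B → A) (xs : List B) (f : A → ℤ) → ∑ (map h xs) f ≡ ∑ xs (f ∘ h)
∑-map h [] f = refl
∑-map h (x ∷ xs) f = cong (_+_ (f (h x))) (∑-map h xs f)

∑-swap : (xs : List A) (ys : List B) (f : A → B → ℤ) →
  ∑ xs (λ x → ∑ ys (f x)) ≡ ∑ ys (λ y → ∑ xs (λ x → f x y))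
∑-swap [] ys f = sym (∑-zero ys)
∑-swap (x ∷ xs) ys f = trans (cong (_+_ (∑ ys (f x))) (∑-swap xs ys f)) (sym (∑-+ ys (f x) _))

∑-filter : {P : A → Set} (P? : Decidable P) (xs : List A) (f : A → ℤ) →
  ∑ (filter P? xs) f ≡ ∑ xs (λ x → ind (P? x) * f x)
∑-filter P? [] f = refl
∑-filter P? (x ∷ xs) f with P? x
... | yes _ = cong₂ _+_ (sym (*-identityˡ (f x))) (∑-filter P? xs f)
... | no _ = trans (∑-filter P? xs f) (sym (+-identityˡ _))

length-filter≡∑ : {P : A → Set} (P? : Decidable P) (xs : List A) →
  + length (filter P? xs) ≡ ∑ xs (λ x → ind (P? x))
length-filter≡∑ P? [] = refl
length-filter≡∑ P? (x ∷ xs) with P? x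
... | yes _ = cong (_+_ 1ℤ) (length-filter≡∑ P? xs)
... | no _ = trans (length-filter≡∑ P? xs) (sym (+-identityˡ _))

∑-point : {xs : List A} {a : A} (f : A → ℤ) → Unique xs → a ∈ xs →
  (∀ x → x ≢ a → f x ≡ 0ℤ) → ∑ xs f ≡ f a
∑-point {xs = x ∷ xs} f u@(_ ∷ _) (here refl) z = trans
  (cong (_+_ (f x)) (trans (∑-cong-∈ xs (λ y y∈ → z y (λ {refl → Unique.Unique[x∷xs]⇒x∉xs u y∈}))) (∑-zero xs)))
  (+-identityʳ (f x))
∑-point {xs = x ∷ xs} f u@(_ ∷ us) (there a∈) z = trans
  (cong₂ _+_ (z x (λ {refl → Unique.Unique[x∷xs]⇒x∉xs u a∈})) (∑-point f us a∈ z)) (+-identityˡ _)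

∑ᶠ : ∀ {n} → (Fin n → ℤ) → ℤ
∑ᶠ {n} = ∑ (allFin n)

∑ᶠ-point : ∀ {n} (f : Fin n → ℤ) (a : Fin n) → (∀ x → x ≢ a → f x ≡ 0ℤ) → ∑ᶠ f ≡ f a
∑ᶠ-point {n} f a = ∑-point f (Unique.allFin⁺ n) (∈-allFin a)

∑ᶠ-const : ∀ {n} (c : ℤ) → ∑ᶠ {n} (λ _ → c) ≡ + n * c
∑ᶠ-const {n} c = trans (∑-const (allFin n) c) (cong (λ k → + k * c) (length-tabulate {n = n} id))

-- Triples

∑ᶠ-suc : ∀ {n} (f : Fin (suc n) → ℤ) → ∑ᶠ f ≡ f zero + ∑ᶠ (f ∘ suc)
∑ᶠ-suc {n} f = cong (_+_ (f zero))
  (trans (cong (λ xs → ∑ xs f) (sym (map-tabulate {n = n} id suc))) (∑-map suc (allFin n) f))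

card≡∑ : ∀ {n} (p : Subset n) → + ∣ p ∣ ≡ ∑ᶠ (λ x → ind (x ∈? p))
card≡∑ [] = refl
card≡∑ (s ∷ p) = trans (card-∷ s) (sym (trans (∑ᶠ-suc (λ x → ind (x ∈? (s ∷ p))))
  (cong (_+_ (ind (zero ∈? (s ∷ p))))
    (∑-cong (allFin _) (λ x → ind-cong (suc x ∈? (s ∷ p)) (x ∈? p) drop-there there)))))
  where
  card-∷ : ∀ s → + ∣ s ∷ p ∣ ≡ ind (zero ∈? (s ∷ p)) + ∑ᶠ (λ x → ind (x ∈? p))
  card-∷ inside = cong (_+_ 1ℤ) (card≡∑ p)
  card-∷ outside = trans (card≡∑ p) (sym (+-identityˡ _))

elements : ∀ {n} → Subset n → List (Fin n)
elements {n} p = filter (_∈? p) (allFin n)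

length-elements : ∀ {n} (p : Subset n) → length (elements p) ≡ ∣ p ∣
length-elements p = +-injective (trans (length-filter≡∑ (_∈? p) (allFin _)) (sym (card≡∑ p)))

elements-unique : ∀ {n} (p : Subset n) → Unique (elements p)
elements-unique {n} p = Unique.filter⁺ (_∈? p) (Unique.allFin⁺ n)

∈-elements⁺ : ∀ {n} {p : Subset n} {x} → x ∈ˢ p → x ∈ elements p
∈-elements⁺ {p = p} = ∈-filter⁺ (_∈? p) (∈-allFin _)

∈-elements⁻ : ∀ {n} {p : Subset n} {x} → x ∈ elements p → x ∈ˢ p
∈-elements⁻ {n} {p} = proj₂ ∘ ∈-filter⁻ (_∈? p) {xs = allFin n}

subsets : ∀ n → List (Subset n)
subsets zero = [] ∷ []
subsets (suc n) = map (inside ∷_) (subsets n) ++ map (outside ∷_) (subsets n)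

∈-subsets : ∀ {n} (p : Subset n) → p ∈ subsets n
∈-subsets [] = here refl
∈-subsets (inside ∷ p) = ∈-++⁺ˡ (∈-map⁺ (inside ∷_) (∈-subsets p))
∈-subsets (outside ∷ p) = ∈-++⁺ʳ _ (∈-map⁺ (outside ∷_) (∈-subsets p))

subsets-unique : ∀ n → Unique (subsets n)
subsets-unique zero = [] ∷ []
subsets-unique (suc n) = Unique.++⁺
  (Unique.map⁺ (λ {refl → refl}) (subsets-unique n))
  (Unique.map⁺ (λ {refl → refl}) (subsets-unique n))
  λ (p∈ , q∈) → disjoint (∈-map⁻ _ p∈) (∈-map⁻ _ q∈)
  where
  disjoint : ∀ {r} → ∃ (λ p → p ∈ subsets n × r ≡ inside ∷ p) → ∃ (λ q → q ∈ subsets n × r ≡ outside ∷ q) → ⊥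
  disjoint (_ , _ , refl) (_ , _ , ())

module _ {v : ℕ} where

  private variable
    i j t x y z x′ y′ z′ : Fin v

  tri : Fin v → Fin v → Fin v → Subset v
  tri x y z = ⁅ x ⁆ ∪ (⁅ y ⁆ ∪ ⁅ z ⁆)

  Distinct : Fin v → Fin v → Fin v → Set
  Distinct x y z = x ≢ y × x ≢ z × y ≢ z

  Distinct⇒Unique : Distinct x y z → Unique (x ∷ y ∷ z ∷ [])
  Distinct⇒Unique (x≢y , x≢z , y≢z) = (x≢y ∷ x≢z ∷ []) ∷ (y≢z ∷ []) ∷ [] ∷ []

  ∈-tri⁻ : t ∈ˢ tri x y z → t ∈ x ∷ y ∷ z ∷ []
  ∈-tri⁻ {x = x} {y} {z} t∈ with x∈p∪q⁻ ⁅ x ⁆ _ t∈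
  ... | inj₁ t∈x = here (x∈⁅y⁆⇒x≡y x t∈x)
  ... | inj₂ t∈yz with x∈p∪q⁻ ⁅ y ⁆ _ t∈yz
  ... | inj₁ t∈y = there (here (x∈⁅y⁆⇒x≡y y t∈y))
  ... | inj₂ t∈z = there (there (here (x∈⁅y⁆⇒x≡y z t∈z)))

  ∈-tri⁺ : t ∈ x ∷ y ∷ z ∷ [] → t ∈ˢ tri x y z
  ∈-tri⁺ (here refl) = x∈p∪q⁺ (inj₁ (x∈⁅x⁆ _))
  ∈-tri⁺ (there (here refl)) = x∈p∪q⁺ (inj₂ (x∈p∪q⁺ (inj₁ (x∈⁅x⁆ _))))
  ∈-tri⁺ (there (there (here refl))) = x∈p∪q⁺ (inj₂ (x∈p∪q⁺ (inj₂ (x∈⁅x⁆ _))))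

  card-tri : Distinct x y z → ∣ tri x y z ∣ ≡ 3
  card-tri {x} {y} {z} d = trans (sym (length-elements (tri x y z)))
    (Unique-↔⇒length-≡ (elements-unique _) (Distinct⇒Unique d) (∈-tri⁻ ∘ ∈-elements⁻) (∈-elements⁺ ∘ ∈-tri⁺))

  -- Two cardinality counts: without a further element, three elements would fit into the list of
  -- `i` and `j`; an element outside `tri i j z` would be a fourth.
  card≡3⇒tri : {B : Subset v} → ∣ B ∣ ≡ 3 → i ≢ j → i ∈ˢ B → j ∈ˢ B →
    ∃ λ z → z ≢ i × z ≢ j × B ≡ tri i j z
  card≡3⇒tri {i} {j} {B} c i≢j i∈ j∈ with any? (λ z → ¬? (z ≟ i) ×-dec (¬? (z ≟ j) ×-dec (z ∈? B)))
  ... | no none = contradiction 3≤2 (ℕ.<⇒≱ ℕ.≤-refl)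
    where
    sub : ∀ {t} → t ∈ elements B → t ∈ i ∷ j ∷ []
    sub {t} t∈ with t ≟ i | t ≟ j
    ... | yes refl | _ = here refl
    ... | no _ | yes refl = there (here refl)
    ... | no t≢i | no t≢j = contradiction (t , t≢i , t≢j , ∈-elements⁻ t∈) none
    3≤2 : 3 ℕ.≤ 2
    3≤2 = subst (ℕ._≤ 2) (trans (length-elements B) c) (Unique-⊆⇒length-≤ (elements-unique B) sub)
  ... | yes (z , z≢i , z≢j , z∈) = z , z≢i , z≢j , ⊆-antisym fwd bwd
    where
    bwd′ : ∀ {t} → t ∈ i ∷ j ∷ z ∷ [] → t ∈ˢ B
    bwd′ (here refl) = i∈
    bwd′ (there (here refl)) = j∈
    bwd′ (there (there (here refl))) = z∈
    bwd : ∀ {t} → t ∈ˢ tri i j z → t ∈ˢ B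
    bwd = bwd′ ∘ ∈-tri⁻
    fwd : ∀ {t} → t ∈ˢ B → t ∈ˢ tri i j z
    fwd {t} t∈ with t ∈? tri i j z
    ... | yes t∈ijz = t∈ijz
    ... | no t∉ = contradiction 4≤3 (ℕ.<⇒≱ ℕ.≤-refl)
      where
      4≤3 : 4 ℕ.≤ 3
      4≤3 = subst (4 ℕ.≤_) (trans (length-elements B) c) (Unique-⊆⇒length-≤
        (((λ {refl → t∉ (∈-tri⁺ (here refl))}) ∷ (λ {refl → t∉ (∈-tri⁺ (there (here refl)))}) ∷
          (λ {refl → t∉ (∈-tri⁺ (there (there (here refl))))}) ∷ []) ∷ Distinct⇒Unique (i≢j , z≢i ∘ sym , z≢j ∘ sym))
        λ {(here refl) → ∈-elements⁺ t∈ ; (there u) → ∈-elements⁺ (bwd′ u)})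

  -- Membership becomes linear in point indicators, so that balance of pairs reduces to a ring
  -- identity.
  ind-∈-tri : Distinct x y z → ∀ i → ind (i ∈? tri x y z) ≡ ind (i ≟ x) + (ind (i ≟ y) + ind (i ≟ z))
  ind-∈-tri {x} {y} {z} (x≢y , x≢z , y≢z) i with i ≟ x | i ≟ y | i ≟ z
  ... | yes refl | yes refl | _ = contradiction refl x≢y
  ... | yes refl | no _ | yes refl = contradiction refl x≢z
  ... | yes refl | no _ | no _ = ind-yes (i ∈? _) (∈-tri⁺ (here refl))
  ... | no _ | yes refl | yes refl = contradiction refl y≢z
  ... | no _ | yes refl | no _ = ind-yes (i ∈? _) (∈-tri⁺ (there (here refl)))
  ... | no _ | no _ | yes refl = ind-yes (i ∈? _) (∈-tri⁺ (there (there (here refl))))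
  ... | no i≢x | no i≢y | no i≢z = ind-no (i ∈? _) λ i∈ → case′ (∈-tri⁻ i∈)
    where
    case′ : i ∈ x ∷ y ∷ z ∷ [] → ⊥
    case′ (here e) = i≢x e
    case′ (there (here e)) = i≢y e
    case′ (there (there (here e))) = i≢z e

  tri-injective : z ≢ x → z ≢ y → tri x y z ≡ tri x y z′ → z ≡ z′
  tri-injective {z} {x} {y} z≢x z≢y e with ∈-tri⁻ (subst (z ∈ˢ_) e (∈-tri⁺ (there (there (here refl)))))
  ... | here p = contradiction p z≢x
  ... | there (here p) = contradiction p z≢y
  ... | there (there (here p)) = p

  SameEdge : Fin v → Fin v → Fin v → Fin v → Set
  SameEdge x y x′ y′ = (x ≡ x′ × y ≡ y′) ⊎ (x ≡ y′ × y ≡ x′)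

  -- Coning from a fixed apex is injective on unordered edges, which keeps the blocks of a trade
  -- distinct.
  tri≡⇒SameEdge : Distinct z x y → tri z x y ≡ tri z x′ y′ → SameEdge x y x′ y′
  tri≡⇒SameEdge {z} {x} {y} (z≢x , z≢y , x≢y) e
    with ∈-tri⁻ (subst (x ∈ˢ_) e (∈-tri⁺ (there (here refl))))
       | ∈-tri⁻ (subst (y ∈ˢ_) e (∈-tri⁺ (there (there (here refl)))))
  ... | here p | _ = contradiction (sym p) z≢x
  ... | there _ | here p = contradiction (sym p) z≢y
  ... | there (here p) | there (here q) = contradiction (trans p (sym q)) x≢y
  ... | there (here p) | there (there (here q)) = inj₁ (p , q)
  ... | there (there (here p)) | there (here q) = inj₂ (p , q)
  ... | there (there (here p)) | there (there (here q)) = contradiction (trans p (sym q)) x≢y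

  others : Fin v → Fin v → List (Fin v)
  others i j = filter (λ z → ¬? (z ≟ i) ×-dec ¬? (z ≟ j)) (allFin v)

  others-unique : ∀ i j → Unique (others i j)
  others-unique i j = Unique.filter⁺ _ (Unique.allFin⁺ v)

  ∈-others⁺ : z ≢ i → z ≢ j → z ∈ others i j
  ∈-others⁺ z≢i z≢j = ∈-filter⁺ _ (∈-allFin _) (z≢i , z≢j)

  ∈-others⁻ : z ∈ others i j → z ≢ i × z ≢ j
  ∈-others⁻ z∈ = proj₂ (∈-filter⁻ _ {xs = allFin v} z∈)

  length-others : i ≢ j → 2 ℕ.+ length (others i j) ≡ v
  length-others {i} {j} i≢j = trans
    (Unique-↔⇒length-≡ {xs = i ∷ j ∷ others i j}
      ((i≢j ∷ All.tabulate (λ z∈ e → proj₁ (∈-others⁻ {i = i} {j} z∈) (sym e))) ∷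
       All.tabulate (λ z∈ e → proj₂ (∈-others⁻ {i = i} {j} z∈) (sym e)) ∷ others-unique i j)
      (Unique.allFin⁺ v) (λ _ → ∈-allFin _) (λ {x} _ → mem x))
    (length-tabulate {n = v} id)
    where
    mem : ∀ x → x ∈ i ∷ j ∷ others i j
    mem x with x ≟ i | x ≟ j
    ... | yes refl | _ = here refl
    ... | no _ | yes refl = there (here refl)
    ... | no x≢i | no x≢j = there (there (∈-others⁺ x≢i x≢j))

-- Trades

ind-× : (d : Dec X) (e : Dec Y) → ind (d ×-dec e) ≡ ind d * ind e
ind-× (yes _) (yes _) = refl
ind-× (yes _) (no _) = refl
ind-× (no _) (yes _) = refl
ind-× (no _) (no _) = refl

AllPairs-injective : {f : A → B} {xs : List A} → AllPairs (λ x y → f x ≢ f y) xs →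
  ∀ {x y} → x ∈ xs → y ∈ xs → f x ≡ f y → x ≡ y
AllPairs-injective _ (here refl) (here refl) _ = refl
AllPairs-injective (r ∷ _) (here refl) (there y∈) e = contradiction e (All.lookup r y∈)
AllPairs-injective (r ∷ _) (there x∈) (here refl) e = contradiction (sym e) (All.lookup r x∈)
AllPairs-injective (_ ∷ rs) (there x∈) (there y∈) e = AllPairs-injective rs x∈ y∈ e

-- Each triple occurs once in `F(v,3)`, so -1 is the least coefficient that can be added; since the
-- trade uses `ε` together with `- ε`, 1 is the greatest.
Small : ℤ → Set
Small ε = ε ≡ -1ℤ ⊎ ε ≡ 0ℤ ⊎ ε ≡ 1ℤ

Small⇒ind-diff : ∀ {ε} → Small ε → ind (ε ℤ.≟ 1ℤ) - ind (ε ℤ.≟ -1ℤ) ≡ ε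
Small⇒ind-diff (inj₁ refl) = refl
Small⇒ind-diff (inj₂ (inj₁ refl)) = refl
Small⇒ind-diff (inj₂ (inj₂ refl)) = refl

Small-neg : ∀ {ε} → Small ε → Small (- ε)
Small-neg (inj₁ refl) = inj₂ (inj₂ refl)
Small-neg (inj₂ (inj₁ refl)) = inj₂ (inj₁ refl)
Small-neg (inj₂ (inj₂ refl)) = inj₁ refl

*-distribˡ-- : ∀ x y z → x * (y - z) ≡ x * y - x * z
*-distribˡ-- = solve-∀

*-distribʳ-- : ∀ x y z → (x - y) * z ≡ x * z - y * z
*-distribʳ-- = solve-∀

module _ {v : ℕ} where

  pairInd : Fin v → Fin v → Subset v → ℤ
  pairInd i j B = ind (i ∈? B) * ind (j ∈? B)

  +pairCount : ∀ i j (L : List (Subset v)) → + pairCount i j L ≡ ∑ L (pairInd i j)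
  +pairCount i j L = trans (length-filter≡∑ (λ B → (i ∈? B) ×-dec (j ∈? B)) L)
    (∑-cong L (λ B → ind-× (i ∈? B) (j ∈? B)))

  pairCount-++ : ∀ i j (L M : List (Subset v)) → pairCount i j (L ++ M) ≡ pairCount i j L ℕ.+ pairCount i j M
  pairCount-++ i j L M = trans (cong length (filter-++ _ L M)) (length-++ (filter _ L))

  pairCount-full : ∀ {i j} {L : List (Subset v)} → i ≢ j → Unique L →
    (∀ {B} → B ∈ L → ∣ B ∣ ≡ 3) → (∀ {B} → ∣ B ∣ ≡ 3 → B ∈ L) → pairCount i j L ≡ v ℕ.∸ 2
  pairCount-full {i} {j} {L} i≢j u sound complete = trans
    (Unique-↔⇒length-≡ (Unique.filter⁺ ij? u) trisUnique fwd bwd)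
    (trans (length-map (tri i j) (others i j)) (cong (ℕ._∸ 2) (length-others i≢j)))
    where
    ij? = λ B → (i ∈? B) ×-dec (j ∈? B)
    trisUnique : Unique (map (tri i j) (others i j))
    trisUnique = AllPairs.map⁺ (AllPairs.map
      (λ (z≢z′ , (z≢i , z≢j) , _) e → z≢z′ (tri-injective z≢i z≢j e))
      (AllPairs-withAll (others-unique i j) (All.tabulate (∈-others⁻ {i = i} {j}))))
    fwd : ∀ {B} → B ∈ filter ij? L → B ∈ map (tri i j) (others i j)
    fwd B∈ with ∈-filter⁻ ij? {xs = L} B∈
    ... | B∈L , i∈ , j∈ with card≡3⇒tri (sound B∈L) i≢j i∈ j∈
    ... | z , z≢i , z≢j , refl = ∈-map⁺ (tri i j) (∈-others⁺ z≢i z≢j)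
    bwd : ∀ {B} → B ∈ map (tri i j) (others i j) → B ∈ filter ij? L
    bwd B∈ with ∈-map⁻ (tri i j) B∈
    ... | z , z∈ , refl with ∈-others⁻ {i = i} {j} z∈
    ... | z≢i , z≢j = ∈-filter⁺ ij? (complete (card-tri (i≢j , z≢i ∘ sym , z≢j ∘ sym)))
      (∈-tri⁺ (here refl) , ∈-tri⁺ (there (here refl)))

  module _ {D : List (Subset v)} (defining : IsDefiningSet v 3 D) where

    -- A nonzero trade with values in {-1,0,1} supported off D turns F(v,3) into another design containing D.
    no-trade : (T : List (Subset v × ℤ)) → AllPairs (λ p q → proj₁ p ≢ proj₁ q) T →
      All (λ (B , ε) → ∣ B ∣ ≡ 3 × B ∉ D × Small ε) T →
      (∀ i j → i ≢ j → ∑ T (λ (B , ε) → ε * pairInd i j B) ≡ 0ℤ) →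
      ∀ {B} → (B , -1ℤ) ∈ T → ⊥
    no-trade T distinct ok balanced {B₀} B₀∈T = absurd
      where
      open DecMembership (Vec.≡-dec {n = v} Bool._≟_) renaming (_∈?_ to _∈ᴸ?_) using ()
      part : ℤ → List (Subset v)
      part c = map proj₁ (filter (λ (_ , ε) → ε ℤ.≟ c) T)
      -- The full design is `rest` together with `minus`. Exchanging `minus` for `plus` gives the
      -- other design, in which every block of `plus` occurs twice.
      minus plus full rest : List (Subset v)
      minus = part -1ℤ
      plus = part 1ℤ
      full = filter (λ B → ∣ B ∣ ℕ.≟ 3) (subsets v)
      rest = filter (λ B → ¬? (B ∈ᴸ? minus)) full
      part⁻ : ∀ {c B} → B ∈ part c → (B , c) ∈ T
      part⁻ {c} B∈ with ∈-map⁻ proj₁ B∈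
      ... | (_ , _) , ∈f , refl with ∈-filter⁻ (λ (_ , ε) → ε ℤ.≟ c) {xs = T} ∈f
      ... | ∈T , refl = ∈T
      part-3 : ∀ {c B} → B ∈ part c → ∣ B ∣ ≡ 3
      part-3 B∈ = proj₁ (All.lookup ok (part⁻ B∈))
      part-unique : ∀ c → Unique (part c)
      part-unique c = AllPairs.map⁺ (AllPairs.filter⁺ _ distinct)
      ∈full : ∀ {B} → ∣ B ∣ ≡ 3 → B ∈ full
      ∈full = ∈-filter⁺ _ (∈-subsets _)
      full-3 : ∀ {B} → B ∈ full → ∣ B ∣ ≡ 3
      full-3 B∈ = proj₂ (∈-filter⁻ (λ B → ∣ B ∣ ℕ.≟ 3) {xs = subsets v} B∈)
      rest⁻ : ∀ {B} → B ∈ rest → B ∈ full × B ∉ minus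
      rest⁻ = ∈-filter⁻ (λ B → ¬? (B ∈ᴸ? minus)) {xs = full}
      ∑-part : ∀ c (g : Subset v → ℤ) → ∑ (part c) g ≡ ∑ T (λ (B , ε) → ind (ε ℤ.≟ c) * g B)
      ∑-part c g = trans
        (∑-map proj₁ (filter (λ (_ , ε) → ε ℤ.≟ c) T) g) (∑-filter (λ (_ , ε) → ε ℤ.≟ c) T (g ∘ proj₁))
      pairs-plus≡minus : ∀ i j → i ≢ j → pairCount i j plus ≡ pairCount i j minus
      pairs-plus≡minus i j i≢j = +-injective (i-j≡0⇒i≡j _ _ (begin
        + pairCount i j plus - + pairCount i j minus
          ≡⟨ cong₂ _-_ (trans (+pairCount i j plus) (∑-part 1ℤ g)) (trans (+pairCount i j minus) (∑-part -1ℤ g)) ⟩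
        ∑ T (λ (B , ε) → ind (ε ℤ.≟ 1ℤ) * g B) - ∑ T (λ (B , ε) → ind (ε ℤ.≟ -1ℤ) * g B)
          ≡⟨ ∑-minus T _ _ ⟨
        ∑ T (λ (B , ε) → ind (ε ℤ.≟ 1ℤ) * g B - ind (ε ℤ.≟ -1ℤ) * g B)
          ≡⟨ ∑-cong-∈ T (λ (B , ε) ∈T → trans (sym (*-distribʳ-- (ind (ε ℤ.≟ 1ℤ)) (ind (ε ℤ.≟ -1ℤ)) (g B)))
               (cong (_* g B) (Small⇒ind-diff (proj₂ (proj₂ (All.lookup ok ∈T)))))) ⟩
        ∑ T (λ (B , ε) → ε * g B)
          ≡⟨ balanced i j i≢j ⟩
        0ℤ ∎))
        where
        open ≡-Reasoning
        g = pairInd i j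
      rest++minus-unique : Unique (rest ++ minus)
      rest++minus-unique = Unique.++⁺ (Unique.filter⁺ _ (Unique.filter⁺ _ (subsets-unique v))) (part-unique -1ℤ)
        λ (∈rest , ∈minus) → proj₂ (rest⁻ ∈rest) ∈minus
      rest++minus-sound : ∀ {B} → B ∈ rest ++ minus → ∣ B ∣ ≡ 3
      rest++minus-sound B∈ with ∈-++⁻ rest B∈
      ... | inj₁ ∈rest = full-3 (proj₁ (rest⁻ ∈rest))
      ... | inj₂ ∈minus = part-3 ∈minus
      rest++minus-complete : ∀ {B} → ∣ B ∣ ≡ 3 → B ∈ rest ++ minus
      rest++minus-complete {B} c with B ∈ᴸ? minus
      ... | yes ∈minus = ∈-++⁺ʳ rest ∈minus
      ... | no ∉minus = ∈-++⁺ˡ (∈-filter⁺ _ (∈full c) ∉minus)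
      design : IsDesign v 3 ((v ℕ.∸ 2) C 1) (rest ++ plus)
      design = All.++⁺ (All.tabulate (full-3 ∘ proj₁ ∘ rest⁻)) (All.tabulate part-3) , λ i j i≢j → begin
        pairCount i j (rest ++ plus)                  ≡⟨ pairCount-++ i j rest plus ⟩
        pairCount i j rest ℕ.+ pairCount i j plus     ≡⟨ cong (pairCount i j rest ℕ.+_) (pairs-plus≡minus i j i≢j) ⟩
        pairCount i j rest ℕ.+ pairCount i j minus     ≡⟨ pairCount-++ i j rest minus ⟨
        pairCount i j (rest ++ minus)                  ≡⟨ pairCount-full i≢j rest++minus-unique rest++minus-sound rest++minus-complete ⟩
        v ℕ.∸ 2                                 ≡⟨ nC1≡n (v ℕ.∸ 2) ⟨
        (v ℕ.∸ 2) C 1    ∎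
        where open ≡-Reasoning
      contains : ∀ {B} → B ∈ D → B ∈ rest ++ plus
      contains ∈D = ∈-++⁺ˡ (∈-filter⁺ _ (∈full (All.lookup (proj₂ (proj₁ defining)) ∈D))
        λ ∈minus → proj₁ (proj₂ (All.lookup ok (part⁻ ∈minus))) ∈D)
      -- `B₀` leaves with `minus` and does not return with `plus`, since a block has a single
      -- coefficient in `T`. Its multiplicity is then 0 instead of 1.
      absent : ∀ {B} → B ∈ rest ++ plus → B ≢ B₀
      absent ∈L refl with ∈-++⁻ rest ∈L
      ... | inj₁ ∈rest = proj₂ (rest⁻ ∈rest) (∈-map⁺ proj₁ (∈-filter⁺ _ B₀∈T refl))
      ... | inj₂ ∈plus with AllPairs-injective distinct B₀∈T (part⁻ ∈plus) refl
      ... | ()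
      absurd : ⊥
      absurd with trans (sym (cong length (filter-none (λ B → Vec.≡-dec Bool._≟_ B B₀) (All.tabulate absent))))
        (proj₂ defining (rest ++ plus) design contains B₀ (proj₁ (All.lookup ok B₀∈T)))
      ... | ()

-- Circuits in common links

-- Row `a` of the unsigned incidence matrix: both ends count with the same sign, so on a single
-- cycle the kernel is nonzero only for even length.
incidence : ∀ {v} → Fin v → Fin v × Fin v × ℤ → ℤ
incidence a (x , y , ε) = ε * (ind (a ≟ x) + ind (a ≟ y))

record Circuit {v : ℕ} (H : Fin v → Fin v → Set) : Set where
  field
    edges    : List (Fin v × Fin v × ℤ)
    adjacent : All (λ (x , y , ε) → H x y × Small ε) edges
    distinct : AllPairs (λ (x , y , _) (x′ , y′ , _) → ¬ SameEdge x y x′ y′) edges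
    balanced : ∀ a → ∑ edges (incidence a) ≡ 0ℤ
    nonzero  : ∃ λ x → ∃ λ y → ∃ λ ε → (x , y , ε) ∈ edges × ε ≢ 0ℤ

-- The part quadratic in `x` and `y` is the same for both apexes and cancels. For `i ≢ j` the
-- products `zi * zj` and `wi * wj` vanish too, and what remains is linear in the incidences at `i`
-- and `j`.
pair-difference : ∀ ε zi zj wi wj xi xj yi yj →
  ε * ((zi + (xi + yi)) * (zj + (xj + yj))) + (- ε) * ((wi + (xi + yi)) * (wj + (xj + yj)))
  ≡ (zi * zj - wi * wj) * ε + ((zi - wi) * (ε * (xj + yj)) + (zj - wj) * (ε * (xi + yi)))
pair-difference = solve-∀

ind-≟-disjoint : ∀ {v} {i j : Fin v} → i ≢ j → ∀ z → ind (i ≟ z) * ind (j ≟ z) ≡ 0ℤ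
ind-≟-disjoint {i = i} {j} i≢j z with i ≟ z | j ≟ z
... | yes refl | yes refl = contradiction refl i≢j
... | yes _ | no _ = refl
... | no _ | yes _ = refl
... | no _ | no _ = refl

module _ {v : ℕ} {D : List (Subset v)} where
  open DecMembership (Vec.≡-dec {n = v} Bool._≟_) renaming (_∈?_ to _∈ᴸ?_) using ()

  Free : Fin v → Fin v → Fin v → Set
  Free x y z = Distinct x y z × tri x y z ∉ D

  Free? : ∀ x y z → Dec (Free x y z)
  Free? x y z = (¬? (x ≟ y) ×-dec (¬? (x ≟ z) ×-dec ¬? (y ≟ z))) ×-dec ¬? (tri x y z ∈ᴸ? D)

  Link : Fin v → Fin v → Fin v → Fin v → Set
  Link z w x y = Free z x y × Free w x y

  -- An alternating circuit g in the common link of z and w gives the trade (z - w) g.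
  link-no-circuit : IsDefiningSet v 3 D → ∀ {z w} → z ≢ w → ¬ Circuit (Link z w)
  link-no-circuit defining {z} {w} z≢w c = absurd
    where
    open Circuit c
    cone : Fin v → (Fin v × Fin v × ℤ) → Subset v
    cone a (x , y , _) = tri a x y
    zT wT : Fin v × Fin v × ℤ → Subset v × ℤ
    zT e@(_ , _ , ε) = cone z e , ε
    wT e@(_ , _ , ε) = cone w e , - ε
    T = map zT edges ++ map wT edges
    link : ∀ {x y ε} → (x , y , ε) ∈ edges → Link z w x y
    link e∈ = proj₁ (All.lookup adjacent e∈)
    -- A cone from `z` contains `z`; a cone from `w` does not, as `z ≢ w` and no link edge passes
    -- through `z`.
    cross : ∀ {p q} → p ∈ map zT edges → q ∈ map wT edges → proj₁ p ≢ proj₁ q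
    cross p∈ q∈ e with ∈-map⁻ zT p∈ | ∈-map⁻ wT q∈
    ... | (x , y , _) , xy∈ , refl | (x′ , y′ , _) , xy′∈ , refl
      with proj₂ (link xy′∈) | ∈-tri⁻ (subst (z ∈ˢ_) e (∈-tri⁺ (here refl)))
         | proj₁ (link xy′∈)
    ... | _ | here z≡w | _ = z≢w z≡w
    ... | _ | there (here z≡x) | (z≢x , _) , _ = z≢x z≡x
    ... | _ | there (there (here z≡y)) | (_ , z≢y , _) , _ = z≢y z≡y
    T-distinct : AllPairs (λ p q → proj₁ p ≢ proj₁ q) T
    T-distinct = AllPairs.++⁺
      (AllPairs.map⁺ (AllPairs.map (λ (ne , ((d , _) , _) , _) → ne ∘ tri≡⇒SameEdge d) links))
      (AllPairs.map⁺ (AllPairs.map (λ (ne , (_ , (d , _)) , _) → ne ∘ tri≡⇒SameEdge d) links))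
      (All.tabulate λ p∈ → All.tabulate λ q∈ → cross p∈ q∈)
      where links = AllPairs-withAll distinct (All.map proj₁ adjacent)
    T-ok : All (λ (B , ε) → ∣ B ∣ ≡ 3 × B ∉ D × Small ε) T
    T-ok = All.++⁺
      (All.map⁺ (All.map (λ (((d , f) , _) , s) → card-tri d , f , s) adjacent))
      (All.map⁺ (All.map (λ ((_ , (d , f)) , s) → card-tri d , f , Small-neg s) adjacent))
    T-balanced : ∀ i j → i ≢ j → ∑ T (λ (B , ε) → ε * pairInd i j B) ≡ 0ℤ
    T-balanced i j i≢j = begin
      ∑ T g
        ≡⟨ ∑-++ (map zT edges) _ g ⟩
      ∑ (map zT edges) g + ∑ (map wT edges) g
        ≡⟨ cong₂ _+_ (∑-map zT edges g) (∑-map wT edges g) ⟩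
      ∑ edges (g ∘ zT) + ∑ edges (g ∘ wT)
        ≡⟨ ∑-+ edges _ _ ⟨
      ∑ edges (λ e → g (zT e) + g (wT e))
        ≡⟨ ∑-cong-∈ edges termwise ⟩
      ∑ edges (λ e → (zi - wi) * incidence j e + (zj - wj) * incidence i e)
        ≡⟨ ∑-+ edges _ _ ⟩
      ∑ edges (λ e → (zi - wi) * incidence j e) + ∑ edges (λ e → (zj - wj) * incidence i e)
        ≡⟨ cong₂ _+_ (∑-* edges (zi - wi) (incidence j)) (∑-* edges (zj - wj) (incidence i)) ⟩
      (zi - wi) * ∑ edges (incidence j) + (zj - wj) * ∑ edges (incidence i)
        ≡⟨ cong₂ (λ s t → (zi - wi) * s + (zj - wj) * t) (balanced j) (balanced i) ⟩
      (zi - wi) * 0ℤ + (zj - wj) * 0ℤ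
        ≡⟨ cong₂ _+_ (*-zeroʳ (zi - wi)) (*-zeroʳ (zj - wj)) ⟩
      0ℤ ∎
      where
      open ≡-Reasoning
      g : Subset v × ℤ → ℤ
      g (B , ε) = ε * pairInd i j B
      zi = ind (i ≟ z)
      zj = ind (j ≟ z)
      wi = ind (i ≟ w)
      wj = ind (j ≟ w)
      rhs : Fin v × Fin v × ℤ → ℤ
      rhs e = (zi - wi) * incidence j e + (zj - wj) * incidence i e
      termwise : ∀ e → e ∈ edges → g (zT e) + g (wT e) ≡ rhs e
      termwise (x , y , ε) e∈ with link e∈
      ... | (dz , _) , (dw , _) = trans
        (cong₂ (λ s t → ε * s + (- ε) * t)
          (cong₂ _*_ (ind-∈-tri dz i) (ind-∈-tri dz j)) (cong₂ _*_ (ind-∈-tri dw i) (ind-∈-tri dw j)))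
        (trans (pair-difference ε zi zj wi wj (ind (i ≟ x)) (ind (j ≟ x)) (ind (i ≟ y)) (ind (j ≟ y)))
        (trans (cong₂ (λ s t → (s - t) * ε + rhs (x , y , ε)) (ind-≟-disjoint i≢j z) (ind-≟-disjoint i≢j w))
        (+-identityˡ _)))
    absurd : ⊥
    absurd with nonzero
    ... | x , y , ε , e∈ , ε≢0 with proj₂ (All.lookup adjacent e∈)
    -- A coefficient -1 is required: the cone from `z` has it if `ε` is -1, the cone from `w` if `ε`
    -- is 1.
    ... | inj₁ refl = no-trade defining T T-distinct T-ok T-balanced (∈-++⁺ˡ (∈-map⁺ zT e∈))
    ... | inj₂ (inj₁ refl) = ε≢0 refl
    ... | inj₂ (inj₂ refl) = no-trade defining T T-distinct T-ok T-balanced (∈-++⁺ʳ (map zT edges) (∈-map⁺ wT e∈))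

-- Breadth-first forests

least : {P : ℕ → Set} → Decidable P → ∀ {d} → P d → ∃ λ m → P m × (∀ {k} → P k → m ℕ.≤ k)
least P? {d} p with P? 0
... | yes p₀ = 0 , p₀ , λ _ → ℕ.z≤n
least P? {zero} p | no ¬p₀ = contradiction p ¬p₀
least {P} P? {suc d} p | no ¬p₀ with least {P ∘ suc} (P? ∘ suc) {d} p
... | m , pₘ , min = suc m , pₘ , λ { {zero} p₀ → contradiction p₀ ¬p₀ ; {suc k} pₖ → ℕ.s≤s (min pₖ) }

module _ {n : ℕ} where

  -- For symmetric `H`, `adj-depth` is the breadth-first property: an edge stays inside a level or
  -- joins consecutive levels. This fixes the parity of the cycle that a non-tree edge closes. At
  -- depth 0 the value of `parent` is arbitrary.
  record Forest (H : Fin n → Fin n → Set) : Set where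
    field
      parent       : Fin n → Fin n
      depth        : Fin n → ℕ
      root         : Fin n → Fin n
      depth0⇒root  : ∀ {x} → depth x ≡ 0 → root x ≡ x
      parent-adj   : ∀ {x k} → depth x ≡ suc k → H x (parent x)
      parent-depth : ∀ {x k} → depth x ≡ suc k → depth (parent x) ≡ k
      adj-root     : ∀ {x y} → H x y → root x ≡ root y
      adj-depth    : ∀ {x y} → H x y → depth x ℕ.≤ suc (depth y)

  module _ {H : Fin n → Fin n → Set} (H? : ∀ x y → Dec (H x y)) (H-sym : ∀ {x y} → H x y → H y x) where

    -- Union by relabelling: each edge `u w` in the list sends the representative of `w` to that of
    -- `u`. A path to the representative is kept because depth will be the distance to it.
    components : (es : List (Fin n × Fin n)) → ∃ λ (r : Fin n → Fin n) →
      (∀ z → Star H z (r z)) × (∀ {u w} → (u , w) ∈ es → H u w → r u ≡ r w)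
    components [] = id , (λ _ → ε⋆) , λ ()
    components ((u , w) ∷ es) with components es | H? u w
    ... | r , conn , joined | no ¬h = r , conn , λ { (here refl) h → contradiction h ¬h ; (there e∈) → joined e∈ }
    ... | r , conn , joined | yes h = r′ , conn′ , λ { (here refl) _ → r′u≡r′w ; (there e∈) h′ → cong merge (joined e∈ h′) }
      where
      merge : Fin n → Fin n
      merge c with c ≟ r w
      ... | yes _ = r u
      ... | no _ = c
      r′ : Fin n → Fin n
      r′ = merge ∘ r
      conn′ : ∀ z → Star H z (r′ z)
      conn′ z with r z ≟ r w
      -- From `z` to the old representative `r w`, back to `w`, across the edge to `u`, and on to
      -- `r u`.
      ... | yes e = conn z ◅◅ subst (λ c → Star H c w) (sym e) (reverse H-sym (conn w)) ◅◅ H-sym h ◅ conn u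
      ... | no _ = conn z
      r′u≡r′w : r′ u ≡ r′ w
      r′u≡r′w with r u ≟ r w | r w ≟ r w
      ... | yes _ | yes _ = refl
      ... | no _ | yes _ = refl
      ... | _ | no ¬p = contradiction refl ¬p

    Walk : ℕ → Fin n → Fin n → Set
    Walk zero x y = x ≡ y
    Walk (suc d) x y = ∃ λ z → H x z × Walk d z y

    Walk? : ∀ d x y → Dec (Walk d x y)
    Walk? zero x y = x ≟ y
    Walk? (suc d) x y = any? (λ z → H? x z ×-dec Walk? d z y)

    Star⇒Walk : ∀ {x y} → Star H x y → ∃ λ d → Walk d x y
    Star⇒Walk ε⋆ = 0 , refl
    Star⇒Walk (h ◅ s) = Product.map suc (λ p → _ , h , p) (Star⇒Walk s)

    -- Depth is the distance to the representative and the parent is the next vertex on a shortest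
    -- walk. Prolonging a shortest walk of a neighbour by one edge gives `adj-depth`, and with it
    -- the exact depth of the parent.
    forest : Forest H
    forest = record
      { parent = λ x → parent-of x (depth x) (shortest x)
      ; depth = depth
      ; root = root
      ; depth0⇒root = λ {x} e → sym (subst (λ d → Walk d x (root x)) e (shortest x))
      ; parent-adj = λ {x} e → proj₁ (parent-props x (depth x) (shortest x) refl e)
      ; parent-depth = λ {x} e → proj₂ (parent-props x (depth x) (shortest x) refl e)
      ; adj-root = adj-root
      ; adj-depth = λ {x} {y} h → minimal x (y , h , subst (Walk (depth y) y) (sym (adj-root h)) (shortest y))
      }
      where
      comps = components (cartesianProduct (allFin n) (allFin n))
      root : Fin n → Fin n
      root = proj₁ comps
      adj-root : ∀ {x y} → H x y → root x ≡ root y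
      adj-root = proj₂ (proj₂ comps) (∈-cartesianProduct⁺ (∈-allFin _) (∈-allFin _))
      distance : ∀ x → ∃ λ m → Walk m x (root x) × (∀ {k} → Walk k x (root x) → m ℕ.≤ k)
      distance x = least (λ d → Walk? d x (root x)) (proj₂ (Star⇒Walk (proj₁ (proj₂ comps) x)))
      depth : Fin n → ℕ
      depth x = proj₁ (distance x)
      shortest : ∀ x → Walk (depth x) x (root x)
      shortest x = proj₁ (proj₂ (distance x))
      minimal : ∀ x {k} → Walk k x (root x) → depth x ℕ.≤ k
      minimal x = proj₂ (proj₂ (distance x))
      -- The length is a separate argument so that the walk can be taken apart; a root gets itself
      -- as default.
      parent-of : ∀ x d → Walk d x (root x) → Fin n
      parent-of x zero _ = x
      parent-of x (suc d) (z , _) = z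
      parent-props : ∀ x d (p : Walk d x (root x)) → depth x ≡ d → ∀ {k} → d ≡ suc k →
        H x (parent-of x d p) × depth (parent-of x d p) ≡ k
      parent-props x (suc d) (z , h , p) e refl = h , ℕ.≤-antisym
        (minimal z (subst (Walk d z) (adj-root h) p))
        (ℕ.s≤s⁻¹ (subst (ℕ._≤ suc (depth z)) e
          (minimal x (z , h , subst (Walk (depth z) z) (sym (adj-root h)) (shortest z)))))

-- Ancestor indicators and boundaries

ZeroOne : ℤ → Set
ZeroOne x = x ≡ 0ℤ ⊎ x ≡ 1ℤ

ind-ZeroOne : (d : Dec X) → ZeroOne (ind d)
ind-ZeroOne (yes _) = inj₂ refl
ind-ZeroOne (no _) = inj₁ refl

Small? : ∀ ε → Dec (Small ε)
Small? ε = (ε ℤ.≟ -1ℤ) ⊎-dec ((ε ℤ.≟ 0ℤ) ⊎-dec (ε ℤ.≟ 1ℤ))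

ZeroOne-diff : ∀ {p q} → ZeroOne p → ZeroOne q → Small (p - q)
ZeroOne-diff (inj₁ refl) (inj₁ refl) = inj₂ (inj₁ refl)
ZeroOne-diff (inj₁ refl) (inj₂ refl) = inj₁ refl
ZeroOne-diff (inj₂ refl) (inj₁ refl) = inj₂ (inj₂ refl)
ZeroOne-diff (inj₂ refl) (inj₂ refl) = inj₂ (inj₁ refl)

Small-even⇒0 : ∀ {p q} → ZeroOne p → ZeroOne q → Small (p + p - (q + q)) → p + p - (q + q) ≡ 0ℤ
Small-even⇒0 (inj₁ refl) (inj₁ refl) _ = refl
Small-even⇒0 (inj₂ refl) (inj₂ refl) _ = refl
Small-even⇒0 (inj₁ refl) (inj₂ refl) (inj₁ ())
Small-even⇒0 (inj₁ refl) (inj₂ refl) (inj₂ (inj₁ ()))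
Small-even⇒0 (inj₁ refl) (inj₂ refl) (inj₂ (inj₂ ()))
Small-even⇒0 (inj₂ refl) (inj₁ refl) (inj₁ ())
Small-even⇒0 (inj₂ refl) (inj₁ refl) (inj₂ (inj₁ ()))
Small-even⇒0 (inj₂ refl) (inj₁ refl) (inj₂ (inj₂ ()))

-- Both sums lie between 0 and 2, so the difference fails to be small only as 2 - 0 or 0 - 2, which
-- determines all four values.
pair-diff-cases : ∀ {p q r s} → ZeroOne p → ZeroOne q → ZeroOne r → ZeroOne s →
  Small (p + q - (r + s)) ⊎ (p ≡ 1ℤ × q ≡ 1ℤ × r ≡ 0ℤ × s ≡ 0ℤ) ⊎ (p ≡ 0ℤ × q ≡ 0ℤ × r ≡ 1ℤ × s ≡ 1ℤ)
pair-diff-cases (inj₁ refl) (inj₁ refl) = λ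
  { (inj₁ refl) (inj₁ refl) → inj₁ (inj₂ (inj₁ refl)) ; (inj₁ refl) (inj₂ refl) → inj₁ (inj₁ refl)
  ; (inj₂ refl) (inj₁ refl) → inj₁ (inj₁ refl) ; (inj₂ refl) (inj₂ refl) → inj₂ (inj₂ (refl , refl , refl , refl)) }
pair-diff-cases (inj₂ refl) (inj₂ refl) = λ
  { (inj₁ refl) (inj₁ refl) → inj₂ (inj₁ (refl , refl , refl , refl)) ; (inj₁ refl) (inj₂ refl) → inj₁ (inj₂ (inj₂ refl))
  ; (inj₂ refl) (inj₁ refl) → inj₁ (inj₂ (inj₂ refl)) ; (inj₂ refl) (inj₂ refl) → inj₁ (inj₂ (inj₁ refl)) }
pair-diff-cases (inj₁ refl) (inj₂ refl) = λ
  { (inj₁ refl) (inj₁ refl) → inj₁ (inj₂ (inj₂ refl)) ; (inj₁ refl) (inj₂ refl) → inj₁ (inj₂ (inj₁ refl))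
  ; (inj₂ refl) (inj₁ refl) → inj₁ (inj₂ (inj₁ refl)) ; (inj₂ refl) (inj₂ refl) → inj₁ (inj₁ refl) }
pair-diff-cases (inj₂ refl) (inj₁ refl) = λ
  { (inj₁ refl) (inj₁ refl) → inj₁ (inj₂ (inj₂ refl)) ; (inj₁ refl) (inj₂ refl) → inj₁ (inj₂ (inj₁ refl))
  ; (inj₂ refl) (inj₁ refl) → inj₁ (inj₂ (inj₁ refl)) ; (inj₂ refl) (inj₂ refl) → inj₁ (inj₁ refl) }

-- The sign of a level. A tree edge joins levels of opposite sign, so this factor turns unsigned
-- incidence into oriented flow along the forest.
altSign : ℕ → ℤ
altSign zero = 1ℤ
altSign (suc k) = - altSign k

altSign-Small : ∀ k {ε} → Small ε → Small (altSign k * ε)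
altSign-Small zero {ε} s = subst Small (sym (*-identityˡ ε)) s
altSign-Small (suc k) {ε} s = subst Small (neg-distribˡ-* (altSign k) ε) (Small-neg (altSign-Small k s))

altSign≢0 : ∀ k → altSign k ≢ 0ℤ
altSign≢0 (suc k) e = altSign≢0 k (neg-injective e)

-- Indicator of the non-roots, the vertices that have an edge to a parent.
isPos : ℕ → ℤ
isPos d = ind (¬? (d ℕ.≟ 0))

module _ {n : ℕ} {H : Fin n → Fin n → Set} (F : Forest H) where
  open Forest F

  -- The number counts the steps still to climb. With it equal to the depth, `anc u` is the
  -- indicator of the path from `u` to its root, `u` included; `anc u y ≡ 1ℤ` says that `u` lies in
  -- the subtree at `y`.
  ancestor : ℕ → Fin n → Fin n → ℤ
  ancestor zero u y = ind (y ≟ u)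
  ancestor (suc k) u y = ind (y ≟ u) + ancestor k (parent u) y

  anc : Fin n → Fin n → ℤ
  anc u = ancestor (depth u) u

  anc-zero : ∀ {u} → depth u ≡ 0 → ∀ y → anc u y ≡ ind (y ≟ u)
  anc-zero {u} e y = cong (λ d → ancestor d u y) e

  anc-suc : ∀ {u k} → depth u ≡ suc k → ∀ y → anc u y ≡ ind (y ≟ u) + anc (parent u) y
  anc-suc {u} e y = trans (cong (λ d → ancestor d u y) e)
    (cong (λ d → ind (y ≟ u) + ancestor d (parent u) y) (sym (parent-depth e)))

  -- Depth drops at every step of the path, so apart from `u` itself the path has only vertices of
  -- smaller depth.
  anc-low : ∀ k {u y} → depth u ≡ k → k ℕ.≤ depth y → y ≢ u → anc u y ≡ 0ℤ
  anc-low zero {u} {y} e _ y≢u = trans (anc-zero e y) (ind-no (y ≟ u) y≢u)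
  anc-low (suc k) {u} {y} e k<y y≢u = trans (anc-suc e y) (cong₂ _+_ (ind-no (y ≟ u) y≢u)
    (anc-low k (parent-depth e) (ℕ.<⇒≤ k<y) λ {refl → ℕ.<-irrefl (sym (parent-depth e)) k<y}))

  -- By `anc-low` the rest of the path does not return to `u`, so no vertex is counted twice.
  anc-ZeroOne : ∀ k {u} → depth u ≡ k → ∀ y → ZeroOne (anc u y)
  anc-ZeroOne zero {u} e y = subst ZeroOne (sym (anc-zero e y)) (ind-ZeroOne (y ≟ u))
  anc-ZeroOne (suc k) {u} e y = subst ZeroOne (sym (anc-suc e y)) (step (y ≟ u))
    where
    step : (d : Dec (y ≡ u)) → ZeroOne (ind d + anc (parent u) y)
    step (yes refl) = inj₂ (cong (_+_ 1ℤ) (anc-low k (parent-depth e) (subst (k ℕ.≤_) (sym e) (ℕ.n≤1+n k))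
      λ y≡p → ℕ.1+n≢n (trans (sym e) (trans (cong depth y≡p) (parent-depth e)))))
    step (no _) = subst ZeroOne (sym (+-identityˡ _)) (anc-ZeroOne k (parent-depth e) y)

  anc-01 : ∀ u y → ZeroOne (anc u y)
  anc-01 u = anc-ZeroOne (depth u) refl

  root-parent : ∀ {u k} → depth u ≡ suc k → root (parent u) ≡ root u
  root-parent e = sym (adj-root (parent-adj e))

  -- The path meets a root only at its end. Adjacent vertices share that end, so their indicators
  -- agree at every root.
  anc-root : ∀ k {u r} → depth u ≡ k → depth r ≡ 0 → anc u r ≡ ind (r ≟ root u)
  anc-root zero {u} {r} e _ = trans (anc-zero e r) (cong (λ s → ind (r ≟ s)) (sym (depth0⇒root e)))
  anc-root (suc k) {u} {r} e r0 = trans (anc-suc e r) (trans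
    (cong₂ _+_ (ind-no (r ≟ u) λ {refl → ℕ.0≢1+n (trans (sym r0) e)}) (anc-root k (parent-depth e) r0))
    (trans (+-identityˡ _) (cong (λ s → ind (r ≟ s)) (root-parent e))))

  childSum : (Fin n → ℤ) → Fin n → ℤ
  childSum c a = ∑ᶠ (λ y → isPos (depth y) * ind (a ≟ parent y) * c y)

  childSum-point : ∀ u a → childSum (λ y → ind (y ≟ u)) a ≡ isPos (depth u) * ind (a ≟ parent u)
  childSum-point u a = trans
    (∑ᶠ-point _ u (λ y y≢u → *-vanishʳ (isPos (depth y) * ind (a ≟ parent y)) (ind-no (y ≟ u) y≢u)))
    (trans (cong (_*_ (isPos (depth u) * ind (a ≟ parent u))) (ind-yes (u ≟ u) refl)) (*-identityʳ _))

  childSum-cong : ∀ {c d : Fin n → ℤ} → (∀ y → c y ≡ d y) → ∀ a → childSum c a ≡ childSum d a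
  childSum-cong e a = ∑-cong (allFin n) (λ y → cong (_*_ (isPos (depth y) * ind (a ≟ parent y))) (e y))

  childSum-+ : ∀ c d a → childSum (λ y → c y + d y) a ≡ childSum c a + childSum d a
  childSum-+ c d a = trans
    (∑-cong (allFin n) (λ y → *-distribˡ-+ (isPos (depth y) * ind (a ≟ parent y)) (c y) (d y))) (∑-+ (allFin n) _ _)

  childSum-minus : ∀ c d a → childSum (λ y → c y - d y) a ≡ childSum c a - childSum d a
  childSum-minus c d a = trans (∑-cong (allFin n) (λ y → *-distribˡ-- (isPos (depth y) * ind (a ≟ parent y)) (c y) (d y)))
    (∑-minus (allFin n) _ _)

  -- Read `c y` as the amount sent from `y` to its parent: `flow` is what leaves `a` minus what its
  -- children send. The value at a root counts as leaving the forest.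
  flow : (Fin n → ℤ) → Fin n → ℤ
  flow c a = c a - childSum c a

  flow-+ : ∀ c d a → flow (λ y → c y + d y) a ≡ flow c a + flow d a
  flow-+ c d a = trans (cong (_-_ (c a + d a)) (childSum-+ c d a)) (lemma (c a) (d a) _ _)
    where
    lemma : ∀ w x y z → w + x - (y + z) ≡ (w - y) + (x - z)
    lemma = solve-∀

  flow-minus : ∀ c d a → flow (λ y → c y - d y) a ≡ flow c a - flow d a
  flow-minus c d a = trans (cong (_-_ (c a - d a)) (childSum-minus c d a)) (lemma (c a) (d a) _ _)
    where
    lemma : ∀ w x y z → w - x - (y - z) ≡ (w - y) - (x - z)
    lemma = solve-∀

  -- The path from `u` carries one unit out through the root, so its only source is `u`; the sum
  -- telescopes along the path.
  flow-anc : ∀ k {u} → depth u ≡ k → ∀ a → flow (anc u) a ≡ ind (a ≟ u)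
  flow-anc zero {u} e a = begin
    anc u a - childSum (anc u) a
      ≡⟨ cong₂ _-_ (anc-zero e a) (childSum-cong (anc-zero e) a) ⟩
    ind (a ≟ u) - childSum (λ y → ind (y ≟ u)) a
      ≡⟨ cong (_-_ (ind (a ≟ u))) (trans (childSum-point u a) (cong (λ d → isPos d * ind (a ≟ parent u)) e)) ⟩
    ind (a ≟ u) - 0ℤ
      ≡⟨ +-identityʳ _ ⟩
    ind (a ≟ u) ∎
    where open ≡-Reasoning
  flow-anc (suc k) {u} e a = begin
    anc u a - childSum (anc u) a
      ≡⟨ cong₂ _-_ (anc-suc e a) (childSum-cong (anc-suc e) a) ⟩
    flow (λ y → ind (y ≟ u) + anc (parent u) y) a
      ≡⟨ flow-+ (λ y → ind (y ≟ u)) (anc (parent u)) a ⟩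
    ind (a ≟ u) - childSum (λ y → ind (y ≟ u)) a + flow (anc (parent u)) a
      ≡⟨ cong₂ (λ s t → ind (a ≟ u) - s + t)
           (trans (childSum-point u a) (trans (cong (λ d → isPos d * ind (a ≟ parent u)) e) (*-identityˡ _)))
           (flow-anc k (parent-depth e) a) ⟩
    ind (a ≟ u) - ind (a ≟ parent u) + ind (a ≟ parent u)
      ≡⟨ lemma (ind (a ≟ u)) (ind (a ≟ parent u)) ⟩
    ind (a ≟ u) ∎
    where
    open ≡-Reasoning
    lemma : ∀ x y → x - y + y ≡ x
    lemma = solve-∀

  nonroots : List (Fin n)
  nonroots = filter (λ y → ¬? (depth y ℕ.≟ 0)) (allFin n)

  treeEdge : (Fin n → ℤ) → Fin n → Fin n × Fin n × ℤ
  treeEdge c y = y , parent y , altSign (depth y) * c y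

  -- The edge from `a` to its parent has the sign of `a`, the edges to its children the opposite
  -- sign. A root has no edge upwards, so `c` must vanish there.
  tree-boundary : ∀ c → (∀ {r} → depth r ≡ 0 → c r ≡ 0ℤ) → ∀ a →
    ∑ (map (treeEdge c) nonroots) (incidence a) ≡ altSign (depth a) * flow c a
  tree-boundary c c-root a = begin
    ∑ (map (treeEdge c) nonroots) (incidence a)
      ≡⟨ trans (∑-map (treeEdge c) nonroots (incidence a))
           (∑-filter (λ y → ¬? (depth y ℕ.≟ 0)) (allFin n) (incidence a ∘ treeEdge c)) ⟩
    ∑ᶠ (λ y → isPos (depth y) * (altSign (depth y) * c y * (ind (a ≟ y) + ind (a ≟ parent y))))
      ≡⟨ ∑-cong (allFin n) (λ y → trans (split (isPos (depth y)) (altSign (depth y)) (c y) _ _)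
           (cong (_+_ (isPos (depth y) * altSign (depth y) * c y * ind (a ≟ y))) (flip-sign y))) ⟩
    ∑ᶠ (λ y → own y + altSign (depth a) * (- (isPos (depth y) * ind (a ≟ parent y) * c y)))
      ≡⟨ ∑-+ (allFin n) _ _ ⟩
    ∑ᶠ own + ∑ᶠ (λ y → altSign (depth a) * (- (isPos (depth y) * ind (a ≟ parent y) * c y)))
      ≡⟨ cong₂ _+_ own-sum (trans (∑-* (allFin n) (altSign (depth a)) _) (cong (_*_ (altSign (depth a))) (∑-neg (allFin n) _))) ⟩
    altSign (depth a) * c a + altSign (depth a) * (- childSum c a)
      ≡⟨ *-distribˡ-+ (altSign (depth a)) (c a) _ ⟨
    altSign (depth a) * flow c a ∎
    where
    open ≡-Reasoning
    own : Fin n → ℤ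
    own y = isPos (depth y) * altSign (depth y) * c y * ind (a ≟ y)
    split : ∀ p s x i j → p * (s * x * (i + j)) ≡ p * s * x * i + p * s * x * j
    split = solve-∀
    flip-sign : ∀ y → isPos (depth y) * altSign (depth y) * c y * ind (a ≟ parent y) ≡
      altSign (depth a) * (- (isPos (depth y) * ind (a ≟ parent y) * c y))
    flip-sign y with depth y in e | a ≟ parent y
    ... | zero | d = sym (*-zeroʳ (altSign (depth a)))
    ... | suc k | no _ = trans (*-zeroʳ (1ℤ * altSign (suc k) * c y)) (sym (*-zeroʳ (altSign (depth a))))
    ... | suc k | yes refl = trans (lemma (altSign k) (c y))
      (cong (λ d → altSign d * (- (1ℤ * 1ℤ * c y))) (sym (parent-depth e)))
      where
      lemma : ∀ s x → 1ℤ * (- s) * x * 1ℤ ≡ s * (- (1ℤ * 1ℤ * x))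
      lemma = solve-∀
    own-sum : ∑ᶠ own ≡ altSign (depth a) * c a
    own-sum = trans (∑ᶠ-point own a (λ y y≢a → *-vanishʳ
        (isPos (depth y) * altSign (depth y) * c y) (ind-no (a ≟ y) (y≢a ∘ sym))))
      (trans (cong (_*_ (isPos (depth a) * altSign (depth a) * c a)) (ind-yes (a ≟ a) refl))
      (trans (*-identityʳ _) at-a))
      where
      at-a : isPos (depth a) * altSign (depth a) * c a ≡ altSign (depth a) * c a
      at-a with depth a in e
      ... | zero = trans (cong (_*_ 0ℤ) (c-root e)) (sym (cong (_*_ 1ℤ) (c-root e)))
      ... | suc k = cong (_* c a) (*-identityˡ (altSign (suc k)))

-- Fundamental cycles

module _ {n : ℕ} {H : Fin n → Fin n → Set} (H-irr : ∀ {x y} → H x y → x ≢ y)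
  (F : Forest H) (no-circuit : ¬ Circuit H) where
  open Forest F

  parent≢ : ∀ {y} → depth y ≢ 0 → ∃ λ k → depth y ≡ suc k × depth (parent y) ≡ k
  parent≢ {y} d with depth y in e
  ... | zero = contradiction refl d
  ... | suc k = k , refl , parent-depth e

  ∈-nonroots⁻ : ∀ {y} → y ∈ nonroots F → depth y ≢ 0
  ∈-nonroots⁻ = proj₂ ∘ ∈-filter⁻ (λ y → ¬? (depth y ℕ.≟ 0)) {xs = allFin n}

  -- The tree edge from y to its parent carries c y up to a sign alternating with depth; es are the non-tree edges.
  circuit-from : (c : Fin n → ℤ) → (∀ y → Small (c y)) → (∀ {r} → depth r ≡ 0 → c r ≡ 0ℤ) →
    (es : List (Fin n × Fin n × ℤ)) →
    All (λ (u , w , ε) → H u w × Small ε) es →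
    All (λ (u , w , _) → ∀ y → depth y ≢ 0 → ¬ SameEdge y (parent y) u w) es →
    AllPairs (λ (x , y , _) (x′ , y′ , _) → ¬ SameEdge x y x′ y′) es →
    (∀ a → altSign (depth a) * flow F c a + ∑ es (incidence a) ≡ 0ℤ) →
    (∃ λ x → ∃ λ y → ∃ λ ε → (x , y , ε) ∈ es × ε ≢ 0ℤ) → ⊥
  circuit-from c small c-root es adj nontree dist bal (x , y , ε , e∈ , ε≢0) = no-circuit record
    { edges = map (treeEdge F c) (nonroots F) ++ es
    ; adjacent = All.++⁺ (All.map⁺ (All.tabulate λ {y} y∈ →
        parent-adj (proj₁ (proj₂ (parent≢ (∈-nonroots⁻ y∈)))) , altSign-Small (depth y) (small y))) adj
    ; distinct = AllPairs.++⁺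
        (AllPairs.map⁺ (AllPairs.map tree-distinct (AllPairs-withAll
          (Unique.filter⁺ (λ y → ¬? (depth y ℕ.≟ 0)) (Unique.allFin⁺ n)) (All.tabulate ∈-nonroots⁻))))
        dist (All.map⁺ (All.tabulate λ {y} y∈ → All.map (λ nt → nt y (∈-nonroots⁻ y∈)) nontree))
    ; balanced = λ a → trans (∑-++ (map (treeEdge F c) (nonroots F)) es (incidence a))
        (trans (cong (_+ ∑ es (incidence a)) (tree-boundary F c c-root a)) (bal a))
    ; nonzero = x , y , ε , ∈-++⁺ʳ _ e∈ , ε≢0
    }
    where
    -- `y` and `y′` cannot each be the parent of the other, as a parent has smaller depth.
    tree-distinct : ∀ {y y′} → y ≢ y′ × depth y ≢ 0 × depth y′ ≢ 0 → ¬ SameEdge y (parent y) y′ (parent y′)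
    tree-distinct (y≢y′ , _) (inj₁ (e , _)) = y≢y′ e
    tree-distinct {y} {y′} (_ , d , d′) (inj₂ (e , e′)) with parent≢ d | parent≢ d′
    ... | k , p , q | k′ , p′ , q′ = ℕ.m≢1+n+m k {1} (trans (trans (sym q) (trans (cong depth e′) p′))
      (cong suc (trans (sym q′) (trans (cong depth (sym e)) p))))

  altSign-point : ∀ a u → altSign (depth a) * ind (a ≟ u) ≡ altSign (depth u) * ind (a ≟ u)
  altSign-point a u with a ≟ u
  ... | yes refl = refl
  ... | no _ = trans (*-zeroʳ (altSign (depth a))) (sym (*-zeroʳ (altSign (depth u))))

  -- Otherwise u-w closes an even cycle.
  even-edge : ∀ {u w} → H u w → depth w ≡ suc (depth u) → parent w ≡ u
  even-edge {u} {w} h e with parent w ≟ u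
  ... | yes p = p
  ... | no p≢u = ⊥-elim (circuit-from c
    (λ y → ZeroOne-diff (anc-01 F u y) (anc-01 F w y))
    (λ {r} r0 → trans (cong₂ _-_ (anc-root F (depth u) refl r0) (anc-root F (depth w) refl r0))
      (trans (cong (λ s → ind (r ≟ s) - ind (r ≟ root w)) (adj-root h)) (+-inverseʳ (ind (r ≟ root w)))))
    -- `w` is one level below `u`, so the difference of the two paths leaves `s` at `u` and
    -- `- (- s)`, again `s`, at `w`. Weight `- s` on the edge cancels both.
    ((u , w , - s) ∷ []) ((h , Small-neg (subst Small (*-identityʳ s) (altSign-Small (depth u) (inj₂ (inj₂ refl))))) ∷ [])
    (nontree ∷ []) ([] ∷ []) balance
    (u , w , _ , here refl , λ s≡0 → altSign≢0 (depth u) (neg-injective s≡0)))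
    where
    s = altSign (depth u)
    c : Fin n → ℤ
    c y = anc F u y - anc F w y
    nontree : ∀ y → depth y ≢ 0 → ¬ SameEdge y (parent y) u w
    nontree y d (inj₁ (refl , refl)) with parent≢ d
    ... | k , p , q = ℕ.m≢1+n+m k {1} (trans (sym q) (trans e (cong suc p)))
    nontree y d (inj₂ (refl , refl)) = p≢u refl
    lemma : ∀ s i j → s * i - (- s) * j + ((- s) * (i + j) + 0ℤ) ≡ 0ℤ
    lemma = solve-∀
    balance : ∀ a → altSign (depth a) * flow F c a + ((- s) * (ind (a ≟ u) + ind (a ≟ w)) + 0ℤ) ≡ 0ℤ
    balance a = trans (cong (_+ ((- s) * (ind (a ≟ u) + ind (a ≟ w)) + 0ℤ)) (begin
        altSign (depth a) * flow F c a
          ≡⟨ cong (_*_ (altSign (depth a))) (trans (flow-minus F (anc F u) (anc F w) a)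
               (cong₂ _-_ (flow-anc F (depth u) refl a) (flow-anc F (depth w) refl a))) ⟩
        altSign (depth a) * (ind (a ≟ u) - ind (a ≟ w))
          ≡⟨ *-distribˡ-- (altSign (depth a)) _ _ ⟩
        altSign (depth a) * ind (a ≟ u) - altSign (depth a) * ind (a ≟ w)
          ≡⟨ cong₂ _-_ (altSign-point a u) (trans (altSign-point a w) (cong (λ d → altSign d * ind (a ≟ w)) e)) ⟩
        s * ind (a ≟ u) - (- s) * ind (a ≟ w) ∎))
      (lemma s (ind (a ≟ u)) (ind (a ≟ w)))
      where open ≡-Reasoning

  -- By `even-edge` the non-tree edges are those inside a level, and each closes an odd cycle. The
  -- order of `u` and `w` selects one orientation.
  OddEdge : Fin n × Fin n → Set
  OddEdge (u , w) = H u w × depth u ≡ depth w × u Fin.< w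

  -- Both ends, or neither end, in the subtree at `y`.
  Inside Outside : Fin n → Fin n × Fin n → Set
  Inside y (u , w) = anc F u y ≡ 1ℤ × anc F w y ≡ 1ℤ
  Outside y (u , w) = anc F u y ≡ 0ℤ × anc F w y ≡ 0ℤ

  -- If the difference `c` of the two pairs of paths were small everywhere, the two edges would
  -- close a circuit. So it is 2 or -2 at some `y`, and `pair-diff-cases` reads off the separation.
  -- For edges in different components a root can serve as `y`.
  odd-edges-separated : ∀ {e e′} → e ≢ e′ → OddEdge e → OddEdge e′ →
    ∃ λ y → (Inside y e × Outside y e′) ⊎ (Outside y e × Inside y e′)
  odd-edges-separated {u , w} {u′ , w′} e≢e′ (h , d , u<w) (h′ , d′ , u′<w′) with all? (λ y → Small? (c y))
    where
    c : Fin n → ℤ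
    c y = anc F u y + anc F w y - (anc F u′ y + anc F w′ y)
  ... | no not-small with ¬∀⟶∃¬ n _ (λ y → Small? _) not-small
  ... | y , ¬small with pair-diff-cases (anc-01 F u y) (anc-01 F w y) (anc-01 F u′ y) (anc-01 F w′ y)
  ... | inj₁ small = contradiction small ¬small
  ... | inj₂ (inj₁ (p , q , r , t)) = y , inj₁ ((p , q) , (r , t))
  ... | inj₂ (inj₂ (p , q , r , t)) = y , inj₂ ((p , q) , (r , t))
  odd-edges-separated {u , w} {u′ , w′} e≢e′ (h , d , u<w) (h′ , d′ , u′<w′) | yes small =
    -- The paths leave `s` at both ends of the first edge and `- s′` at both ends of the second; the
    -- edge weights cancel these.
    ⊥-elim (circuit-from c small c-root ((u , w , - s) ∷ (u′ , w′ , s′) ∷ [])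
      ((h , Small-neg (sign-small u)) ∷ (h′ , sign-small u′) ∷ [])
      (nontree d ∷ nontree d′ ∷ []) ((distinct ∷ []) ∷ [] ∷ []) balance
      (u , w , _ , here refl , λ s≡0 → altSign≢0 (depth u) (neg-injective s≡0)))
    where
    s = altSign (depth u)
    s′ = altSign (depth u′)
    c : Fin n → ℤ
    c y = anc F u y + anc F w y - (anc F u′ y + anc F w′ y)
    sign-small : ∀ x → Small (altSign (depth x))
    sign-small x = subst Small (*-identityʳ _) (altSign-Small (depth x) (inj₂ (inj₂ refl)))
    same-at-root : ∀ {x y r} → H x y → depth r ≡ 0 → anc F y r ≡ anc F x r
    same-at-root {x} {y} {r} h r0 = trans (anc-root F (depth y) refl r0)
      (trans (cong (λ t → ind (r ≟ t)) (sym (adj-root h))) (sym (anc-root F (depth x) refl r0)))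
    -- At a root the two ends of each edge agree, so `c` is even there, and an even small value is
    -- 0.
    c-root : ∀ {r} → depth r ≡ 0 → c r ≡ 0ℤ
    c-root {r} r0 = trans c≡ (Small-even⇒0 (anc-01 F u r) (anc-01 F u′ r) (subst Small c≡ (small r)))
      where
      c≡ : c r ≡ anc F u r + anc F u r - (anc F u′ r + anc F u′ r)
      c≡ = cong₂ (λ p q → anc F u r + p - (anc F u′ r + q)) (same-at-root h r0) (same-at-root h′ r0)
    nontree : ∀ {x z} → depth x ≡ depth z → ∀ y → depth y ≢ 0 → ¬ SameEdge y (parent y) x z
    nontree e y y≢0 same with parent≢ y≢0
    nontree e y y≢0 (inj₁ (refl , refl)) | k , p , q = ℕ.1+n≢n (trans (sym p) (trans e q))
    nontree e y y≢0 (inj₂ (refl , refl)) | k , p , q = ℕ.1+n≢n (trans (sym p) (trans (sym e) q))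
    distinct : ¬ SameEdge u w u′ w′
    distinct (inj₁ (refl , refl)) = e≢e′ refl
    distinct (inj₂ (refl , refl)) = ℕ.<-asym u<w u′<w′
    lemma : ∀ s s′ i j i′ j′ → (s * i + s * j) - (s′ * i′ + s′ * j′) + ((- s) * (i + j) + (s′ * (i′ + j′) + 0ℤ)) ≡ 0ℤ
    lemma = solve-∀
    distrib : ∀ t i j i′ j′ → t * ((i + j) - (i′ + j′)) ≡ (t * i + t * j) - (t * i′ + t * j′)
    distrib = solve-∀
    flow-pair : ∀ x z a → flow F (λ y → anc F x y + anc F z y) a ≡ ind (a ≟ x) + ind (a ≟ z)
    flow-pair x z a = trans (flow-+ F (anc F x) (anc F z) a)
      (cong₂ _+_ (flow-anc F (depth x) refl a) (flow-anc F (depth z) refl a))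
    sign-pair : ∀ {x z} → depth x ≡ depth z → ∀ a →
      altSign (depth a) * ind (a ≟ x) + altSign (depth a) * ind (a ≟ z) ≡
      altSign (depth x) * ind (a ≟ x) + altSign (depth x) * ind (a ≟ z)
    sign-pair {x} {z} e a = cong₂ _+_ (altSign-point a x)
      (trans (altSign-point a z) (cong (λ d → altSign d * ind (a ≟ z)) (sym e)))
    es = (u , w , - s) ∷ (u′ , w′ , s′) ∷ []
    balance : ∀ a → altSign (depth a) * flow F c a + ∑ es (incidence a) ≡ 0ℤ
    balance a = trans (cong (_+ ∑ es (incidence a)) (begin
        altSign (depth a) * flow F c a
          ≡⟨ cong (_*_ (altSign (depth a))) (trans (flow-minus F (λ y → anc F u y + anc F w y) (λ y → anc F u′ y + anc F w′ y) a)
               (cong₂ _-_ (flow-pair u w a) (flow-pair u′ w′ a))) ⟩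
        altSign (depth a) * ((ind (a ≟ u) + ind (a ≟ w)) - (ind (a ≟ u′) + ind (a ≟ w′)))
          ≡⟨ distrib (altSign (depth a)) _ _ _ _ ⟩
        (altSign (depth a) * ind (a ≟ u) + altSign (depth a) * ind (a ≟ w)) -
        (altSign (depth a) * ind (a ≟ u′) + altSign (depth a) * ind (a ≟ w′))
          ≡⟨ cong₂ _-_ (sign-pair d a) (sign-pair d′ a) ⟩
        (s * ind (a ≟ u) + s * ind (a ≟ w)) - (s′ * ind (a ≟ u′) + s′ * ind (a ≟ w′)) ∎))
      (lemma s s′ (ind (a ≟ u)) (ind (a ≟ w)) (ind (a ≟ u′)) (ind (a ≟ w′)))
      where open ≡-Reasoning

  -- At depth 0 both ends would be the root of the same component, hence equal.
  odd-depth : ∀ {u w} → OddEdge (u , w) → ∃ λ k → depth w ≡ suc k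
  odd-depth {u} {w} (h , d , _) with depth w in e
  ... | suc k = k , refl
  ... | zero = contradiction (trans (sym (depth0⇒root d)) (trans (adj-root h) (depth0⇒root e))) (H-irr h)

  -- Three vertices of the odd cycle closed by a non-tree edge.
  triad : Fin n × Fin n → List (Fin n)
  triad (u , w) = u ∷ w ∷ parent w ∷ []

  triad-unique : ∀ {e} → OddEdge e → Unique (triad e)
  triad-unique {u , w} o@(h , d , _) with odd-depth o
  ... | k , e = (H-irr h ∷ (λ {refl → ℕ.1+n≢n (trans (sym e) (trans (sym d) (parent-depth e)))}) ∷ []) ∷
    ((λ p → ℕ.1+n≢n (trans (sym e) (trans (cong depth p) (parent-depth e)))) ∷ []) ∷ [] ∷ []

  -- Only `parent w` needs an argument: it lies outside the subtree at `y` only if `y ≡ w`, but `w`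
  -- is no ancestor of the other vertex `u` of its level.
  triad-inside : ∀ {e y} → OddEdge e → Inside y e → All (λ t → anc F t y ≡ 1ℤ) (triad e)
  triad-inside {u , w} {y} o@(h , d , _) (p , q) with odd-depth o
  ... | k , e = p ∷ q ∷ above (y ≟ w) ∷ []
    where
    above : Dec (y ≡ w) → anc F (parent w) y ≡ 1ℤ
    above (yes refl) with trans (sym p) (anc-low F (depth u) refl (ℕ.≤-reflexive d) (H-irr h ∘ sym))
    ... | ()
    above (no y≢w) = trans (sym (+-identityˡ _)) (trans (cong (_+ anc F (parent w) y) (sym (ind-no (y ≟ w) y≢w)))
      (trans (sym (anc-suc F e y)) q))

  triad-outside : ∀ {e y} → OddEdge e → Outside y e → All (λ t → anc F t y ≡ 0ℤ) (triad e)
  triad-outside {u , w} {y} o (p , q) with odd-depth o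
  ... | k , e = p ∷ q ∷ zero-summand (ind-ZeroOne (y ≟ w)) (anc-01 F (parent w) y) (trans (sym (anc-suc F e y)) q) ∷ []
    where
    zero-summand : ∀ {a b} → ZeroOne a → ZeroOne b → a + b ≡ 0ℤ → b ≡ 0ℤ
    zero-summand _ (inj₁ b0) _ = b0
    zero-summand (inj₁ refl) (inj₂ refl) ()
    zero-summand (inj₂ refl) (inj₂ refl) ()

  -- A common vertex would lie both in and out of the subtree that separates the edges.
  triads-disjoint : ∀ {e e′} → e ≢ e′ × OddEdge e × OddEdge e′ → Disjoint (triad e) (triad e′)
  triads-disjoint (e≢e′ , o , o′) (t∈ , t∈′) with odd-edges-separated e≢e′ o o′
  ... | y , inj₁ (i , o″) with trans (sym (All.lookup (triad-inside o i) t∈)) (All.lookup (triad-outside o′ o″) t∈′)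
  ... | ()
  triads-disjoint (e≢e′ , o , o′) (t∈ , t∈′) | y , inj₂ (o″ , i)
    with trans (sym (All.lookup (triad-inside o′ i) t∈′)) (All.lookup (triad-outside o o″) t∈)
  ... | ()

-- Counting edges

length-concat-const : ∀ {k} {f : A → List B} (xs : List A) → (∀ x → length (f x) ≡ k) →
  length (concat (map f xs)) ≡ length xs ℕ.* k
length-concat-const [] _ = refl
length-concat-const {f = f} (x ∷ xs) e = trans (length-++ (f x)) (cong₂ ℕ._+_ (e x) (length-concat-const xs e))

∑-cartesianProduct : (xs : List A) (ys : List B) (f : A × B → ℤ) →
  ∑ (cartesianProduct xs ys) f ≡ ∑ xs (λ x → ∑ ys (λ y → f (x , y)))
∑-cartesianProduct [] ys f = refl
∑-cartesianProduct (x ∷ xs) ys f = trans (∑-++ (map (x ,_) ys) _ f)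
  (cong₂ _+_ (∑-map (x ,_) ys f) (∑-cartesianProduct xs ys f))

0≤* : ∀ {x y} → 0ℤ ≤ x → 0ℤ ≤ y → 0ℤ ≤ x * y
0≤* {+ m} {+ n} _ _ = subst (0ℤ ≤_) (pos-* m n) (+≤+ ℕ.z≤n)

module _ {n : ℕ} {H : Fin n → Fin n → Set} (H? : ∀ x y → Dec (H x y)) (H-sym : ∀ {x y} → H x y → H y x)
  (H-irr : ∀ {x y} → H x y → x ≢ y) (F : Forest H) (no-circuit : ¬ Circuit H) where
  open Forest F

  private
    Odd : Fin n × Fin n → Set
    Odd = OddEdge H-irr F no-circuit

  Odd? : ∀ e → Dec (Odd e)
  Odd? (u , w) = H? u w ×-dec ((depth u ℕ.≟ depth w) ×-dec (u Fin.<? w))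

  oddEdges : List (Fin n × Fin n)
  oddEdges = filter Odd? (cartesianProduct (allFin n) (allFin n))

  -- Each ordered adjacent pair is charged by comparing depths: a change of level makes it a tree
  -- edge by `even-edge`, equal depth an odd edge. Every edge has two orientations, hence the
  -- doubled counts.
  edge-total : ∑ᶠ (λ x → ∑ᶠ λ y → ind (H? x y)) ≤
    (+ length (nonroots F) + + length (nonroots F)) + (+ length oddEdges + + length oddEdges)
  edge-total = begin
    ∑ᶠ (λ x → ∑ᶠ λ y → ind (H? x y))
      ≤⟨ ∑-mono (allFin n) (λ x → ∑-mono (allFin n) (λ y → classify x y (H? x y))) ⟩
    ∑ᶠ (λ x → ∑ᶠ λ y → (tree x y + tree y x) + (odd x y + odd y x))
      ≡⟨ ∑∑-+ (λ x y → tree x y + tree y x) (λ x y → odd x y + odd y x) ⟩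
    ∑ᶠ (λ x → ∑ᶠ λ y → tree x y + tree y x) + ∑ᶠ (λ x → ∑ᶠ λ y → odd x y + odd y x)
      ≡⟨ cong₂ _+_ (∑∑-+ tree (λ x y → tree y x)) (∑∑-+ odd (λ x y → odd y x)) ⟩
    (∑ᶠ (λ x → ∑ᶠ (tree x)) + ∑ᶠ (λ x → ∑ᶠ λ y → tree y x)) + (∑ᶠ (λ x → ∑ᶠ (odd x)) + ∑ᶠ (λ x → ∑ᶠ λ y → odd y x))
      ≡⟨ cong₂ _+_ (cong (_+ ∑ᶠ (λ x → ∑ᶠ λ y → tree y x)) (∑-swap (allFin n) (allFin n) tree))
           (cong (_+_ (∑ᶠ (λ x → ∑ᶠ (odd x)))) (∑-swap (allFin n) (allFin n) (λ x y → odd y x))) ⟩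
    (∑ᶠ (λ x → ∑ᶠ λ y → tree y x) + ∑ᶠ (λ x → ∑ᶠ λ y → tree y x)) + (∑ᶠ (λ x → ∑ᶠ (odd x)) + ∑ᶠ (λ x → ∑ᶠ (odd x)))
      ≡⟨ cong₂ (λ s t → (s + s) + (t + t)) tree-sum odd-sum ⟩
    (+ length (nonroots F) + + length (nonroots F)) + (+ length oddEdges + + length oddEdges) ∎
    where
    open ≤-Reasoning
    tree odd : Fin n → Fin n → ℤ
    tree x y = isPos (depth y) * ind (x ≟ parent y)
    odd x y = ind (Odd? (x , y))
    ∑∑-+ : ∀ (f g : Fin n → Fin n → ℤ) →
      ∑ᶠ (λ x → ∑ᶠ λ y → f x y + g x y) ≡ ∑ᶠ (λ x → ∑ᶠ (f x)) + ∑ᶠ (λ x → ∑ᶠ (g x))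
    ∑∑-+ f g = trans (∑-cong (allFin n) (λ x → ∑-+ (allFin n) (f x) (g x))) (∑-+ (allFin n) _ _)
    tree-sum : ∑ᶠ (λ x → ∑ᶠ λ y → tree y x) ≡ + length (nonroots F)
    tree-sum = trans (∑-cong (allFin n) (λ x → trans
        (∑ᶠ-point (λ y → tree y x) (parent x) (λ y y≢p → *-vanishʳ (isPos (depth x)) (ind-no (y ≟ parent x) y≢p)))
        (trans (cong (_*_ (isPos (depth x))) (ind-yes (parent x ≟ parent x) refl)) (*-identityʳ _))))
      (sym (length-filter≡∑ (λ y → ¬? (depth y ℕ.≟ 0)) (allFin n)))
    odd-sum : ∑ᶠ (λ x → ∑ᶠ (odd x)) ≡ + length oddEdges
    odd-sum = sym (trans (length-filter≡∑ Odd? (cartesianProduct (allFin n) (allFin n)))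
      (∑-cartesianProduct (allFin n) (allFin n) (λ e → ind (Odd? e))))
    0≤tree : ∀ x y → 0ℤ ≤ tree x y
    0≤tree x y = 0≤* (0≤ind (¬? (depth y ℕ.≟ 0))) (0≤ind (x ≟ parent y))
    tree≡1 : ∀ {x y} → depth y ≡ suc (depth x) → parent y ≡ x → tree x y ≡ 1ℤ
    tree≡1 {x} {y} e p = cong₂ _*_ (cong isPos e) (ind-yes (x ≟ parent y) (sym p))
    four : ∀ {a b c d a′ b′ c′ d′} → a′ ≤ a → b′ ≤ b → c′ ≤ c → d′ ≤ d → a′ + b′ + (c′ + d′) ≤ a + b + (c + d)
    four p q r s = +-mono-≤ (+-mono-≤ p q) (+-mono-≤ r s)
    classify : ∀ x y (d : Dec (H x y)) → ind d ≤ (tree x y + tree y x) + (odd x y + odd y x)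
    classify x y (no _) = four (0≤tree x y) (0≤tree y x) (0≤ind (Odd? (x , y))) (0≤ind (Odd? (y , x)))
    classify x y (yes h) with ℕ.<-cmp (depth x) (depth y)
    ... | tri< lt _ _ = four {a′ = 1ℤ} (≤-reflexive (sym (tree≡1 e (even-edge H-irr F no-circuit h e))))
          (0≤tree y x) (0≤ind (Odd? (x , y))) (0≤ind (Odd? (y , x)))
      where e = ℕ.≤-antisym (adj-depth (H-sym h)) lt
    ... | tri> _ _ gt = four {b′ = 1ℤ} (0≤tree x y)
          (≤-reflexive (sym (tree≡1 e (even-edge H-irr F no-circuit (H-sym h) e))))
          (0≤ind (Odd? (x , y))) (0≤ind (Odd? (y , x)))
      where e = ℕ.≤-antisym (adj-depth h) gt
    ... | tri≈ _ e _ with Fin.<-cmp x y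
    ... | tri≈ _ x≡y _ = contradiction x≡y (H-irr h)
    ... | tri< x<y _ _ = four {c′ = 1ℤ} (0≤tree x y) (0≤tree y x)
          (≤-reflexive (sym (ind-yes (Odd? (x , y)) (h , e , x<y)))) (0≤ind (Odd? (y , x)))
    ... | tri> _ _ y<x = four {d′ = 1ℤ} (0≤tree x y) (0≤tree y x)
          (0≤ind (Odd? (x , y))) (≤-reflexive (sym (ind-yes (Odd? (y , x)) (H-sym h , sym e , y<x))))

  module _ {z w t : Fin n} (z≢w : z ≢ w) (z-isolated : ∀ {x} → ¬ H z x) (w-isolated : ∀ {x} → ¬ H w x)
    (t≢z : t ≢ z) (t≢w : t ≢ w) where

    isolated⇒root : ∀ {a} → (∀ {x} → ¬ H a x) → depth a ≡ 0
    isolated⇒root {a} iso with depth a in e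
    ... | zero = refl
    ... | suc k = contradiction (parent-adj e) iso

    -- Climbing never reaches `z` or `w`, since a vertex without neighbours is nobody's parent. The
    -- extra root improves the bound on tree edges from `n - 2` to `n - 3`.
    third-root : ∀ k {x} → depth x ≡ k → x ≢ z → x ≢ w → ∃ λ r → depth r ≡ 0 × r ≢ z × r ≢ w
    third-root zero {x} e x≢z x≢w = x , e , x≢z , x≢w
    third-root (suc k) e _ _ = third-root k (parent-depth e)
      (λ p → z-isolated (H-sym (subst (H _) p (parent-adj e)))) (λ p → w-isolated (H-sym (subst (H _) p (parent-adj e))))

    nonroots-bound : 3 ℕ.+ length (nonroots F) ℕ.≤ n
    nonroots-bound with third-root (depth t) refl t≢z t≢w
    ... | r , r0 , r≢z , r≢w = Unique⇒length≤n {xs = z ∷ w ∷ r ∷ nonroots F}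
      ((z≢w ∷ (r≢z ∘ sym) ∷ fresh (isolated⇒root z-isolated)) ∷
       ((r≢w ∘ sym) ∷ fresh (isolated⇒root w-isolated)) ∷ fresh r0 ∷
       Unique.filter⁺ (λ y → ¬? (depth y ℕ.≟ 0)) (Unique.allFin⁺ n))
      where
      fresh : ∀ {a} → depth a ≡ 0 → All (a ≢_) (nonroots F)
      fresh a0 = All.tabulate λ {y} y∈ → λ {refl → ∈-nonroots⁻ H-irr F no-circuit y∈ a0}

    -- The disjoint triads miss `z` and `w`, because each vertex of a triad has a neighbour.
    oddEdges-bound : 2 ℕ.+ length oddEdges ℕ.* 3 ℕ.≤ n
    oddEdges-bound = subst (λ k → 2 ℕ.+ k ℕ.≤ n) (length-concat-const oddEdges (λ _ → refl))
      (Unique⇒length≤n {xs = z ∷ w ∷ concat (map (triad H-irr F no-circuit) oddEdges)}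
        ((z≢w ∷ fresh z-isolated) ∷ fresh w-isolated ∷
         Unique.concat⁺ (All.map⁺ (All.map (triad-unique H-irr F no-circuit) odd))
           (AllPairs.map⁺ (AllPairs.map (triads-disjoint H-irr F no-circuit)
             (AllPairs-withAll (Unique.filter⁺ Odd? (Unique.cartesianProduct⁺ (Unique.allFin⁺ n) (Unique.allFin⁺ n))) odd)))))
      where
      odd : All Odd oddEdges
      odd = All.tabulate (proj₂ ∘ ∈-filter⁻ Odd? {xs = cartesianProduct (allFin n) (allFin n)})
      triad-avoids : ∀ {a} → (∀ {x} → ¬ H a x) → ∀ {e} → Odd e → All (a ≢_) (triad H-irr F no-circuit e)
      triad-avoids iso o@(h , _ , _) = (λ {refl → iso h}) ∷ (λ {refl → iso (H-sym h)}) ∷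
        (λ {refl → iso (H-sym (parent-adj (proj₂ (odd-depth H-irr F no-circuit o))))}) ∷ []
      fresh : ∀ {a} → (∀ {x} → ¬ H a x) → All (a ≢_) (concat (map (triad H-irr F no-circuit) oddEdges))
      fresh iso = All.concat⁺ (All.map⁺ (All.map (triad-avoids iso) odd))

    -- The sum over ordered pairs counts every edge twice. After multiplication by 3, the tree bound
    -- enters with weight 6 and the odd bound with weight 2: 22 is 6 * 3 + 2 * 2, and 8 is 6 + 2.
    edge-bound : + 3 * ∑ᶠ (λ x → ∑ᶠ λ y → ind (H? x y)) + + 22 ≤ + 8 * + n
    edge-bound = begin
      + 3 * ∑ᶠ (λ x → ∑ᶠ λ y → ind (H? x y)) + + 22
        ≤⟨ +-monoˡ-≤ (+ 22) (*-monoˡ-≤-nonNeg (+ 3) edge-total) ⟩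
      + 3 * ((+ t′ + + t′) + (+ m + + m)) + + 22
        ≡⟨ lemma (+ t′) (+ m) ⟩
      + 6 * (+ 3 + + t′) + + 2 * (+ 2 + + m * + 3)
        ≡⟨ cong (λ k → + 6 * (+ 3 + + t′) + + 2 * (+ 2 + k)) (sym (pos-* m 3)) ⟩
      + 6 * + (3 ℕ.+ t′) + + 2 * + (2 ℕ.+ m ℕ.* 3)
        ≤⟨ +-mono-≤ (*-monoˡ-≤-nonNeg (+ 6) (+≤+ nonroots-bound)) (*-monoˡ-≤-nonNeg (+ 2) (+≤+ oddEdges-bound)) ⟩
      + 6 * + n + + 2 * + n
        ≡⟨ *-distribʳ-+ (+ n) (+ 6) (+ 2) ⟨
      + 8 * + n ∎
      where
      open ≤-Reasoning
      t′ = length (nonroots F)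
      m = length oddEdges
      lemma : ∀ t m → + 3 * ((t + t) + (m + m)) + + 22 ≡ + 6 * (+ 3 + t) + + 2 * (+ 2 + m * + 3)
      lemma = solve-∀

-- Counting free triples

-- Σ_y (f x - f y)² ≥ 0 supplies the cross terms of the induction step.
cauchy-schwarz : (xs : List A) (f : A → ℤ) → ∑ xs f * ∑ xs f ≤ + length xs * ∑ xs (λ x → f x * f x)
cauchy-schwarz [] f = ≤-refl
cauchy-schwarz (x ∷ xs) f = begin
  (f x + S) * (f x + S)
    ≤⟨ i≤i+j _ _ {{nonNegative cross≥0}} ⟩
  (f x + S) * (f x + S) + (k * (f x * f x) + (Q - + 2 * f x * S))
    ≡⟨ lemma (f x) S k Q ⟩
  f x * f x + k * (f x * f x) + Q + S * S
    ≤⟨ +-monoʳ-≤ (f x * f x + k * (f x * f x) + Q) (cauchy-schwarz xs f) ⟩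
  f x * f x + k * (f x * f x) + Q + k * Q
    ≡⟨ lemma₂ (f x * f x) k Q ⟩
  (1ℤ + k) * (f x * f x + Q) ∎
  where
  open ≤-Reasoning
  S = ∑ xs f
  Q = ∑ xs (λ y → f y * f y)
  k = + length xs
  lemma : ∀ a S k Q → (a + S) * (a + S) + (k * (a * a) + (Q - + 2 * a * S)) ≡ a * a + k * (a * a) + Q + S * S
  lemma = solve-∀
  lemma₂ : ∀ a k Q → a + k * a + Q + k * Q ≡ (1ℤ + k) * (a + Q)
  lemma₂ = solve-∀
  square : ∀ a b → (a - b) * (a - b) ≡ a * a + (b * b - + 2 * a * b)
  square = solve-∀
  0≤square : ∀ a → 0ℤ ≤ a * a
  0≤square (+ m) = subst (0ℤ ≤_) (pos-* m m) (+≤+ ℕ.z≤n)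
  0≤square -[1+ m ] = +≤+ ℕ.z≤n
  cross≥0 : 0ℤ ≤ k * (f x * f x) + (Q - + 2 * f x * S)
  cross≥0 = begin
    0ℤ
      ≡⟨ ∑-zero xs ⟨
    ∑ xs (λ _ → 0ℤ)
      ≤⟨ ∑-mono xs (λ y → 0≤square (f x - f y)) ⟩
    ∑ xs (λ y → (f x - f y) * (f x - f y))
      ≡⟨ ∑-cong xs (λ y → square (f x) (f y)) ⟩
    ∑ xs (λ y → f x * f x + (f y * f y - + 2 * f x * f y))
      ≡⟨ trans (∑-+ xs (λ _ → f x * f x) (λ y → f y * f y - + 2 * f x * f y)) (cong₂ _+_ (∑-const xs (f x * f x)) (trans (∑-minus xs (λ y → f y * f y) (λ y → + 2 * f x * f y))
           (cong (_-_ Q) (∑-* xs (+ 2 * f x) f)))) ⟩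
    k * (f x * f x) + (Q - + 2 * f x * S) ∎

distinctPairs : ∀ n → List (Fin n × Fin n)
distinctPairs n = filter (λ (x , y) → ¬? (x ≟ y)) (cartesianProduct (allFin n) (allFin n))

∈-distinctPairs⁻ : ∀ {n} {e : Fin n × Fin n} → e ∈ distinctPairs n → proj₁ e ≢ proj₂ e
∈-distinctPairs⁻ {n} = proj₂ ∘ ∈-filter⁻ (λ (x , y) → ¬? (x ≟ y)) {xs = cartesianProduct (allFin n) (allFin n)}

∑-distinctPairs : ∀ {n} (f : Fin n × Fin n → ℤ) →
  ∑ (distinctPairs n) f ≡ ∑ᶠ (λ x → ∑ᶠ λ y → ind (¬? (x ≟ y)) * f (x , y))
∑-distinctPairs {n} f = trans (∑-filter (λ (x , y) → ¬? (x ≟ y)) (cartesianProduct (allFin n) (allFin n)) f)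
  (∑-cartesianProduct (allFin n) (allFin n) (λ (x , y) → ind (¬? (x ≟ y)) * f (x , y)))

-- The square of the sum without its diagonal. For a 0-1 function with sum d this is d(d - 1), which
-- serves to count ordered pairs of points, pairs in a block, and pairs of free triples on xy.
∑-distinctPairs-product : ∀ {n} (g : Fin n → ℤ) →
  ∑ (distinctPairs n) (λ (x , y) → g x * g y) ≡ ∑ᶠ g * ∑ᶠ g - ∑ᶠ (λ x → g x * g x)
∑-distinctPairs-product {n} g = trans (∑-distinctPairs (λ (x , y) → g x * g y)) (begin
  ∑ᶠ (λ x → ∑ᶠ λ y → ind (¬? (x ≟ y)) * (g x * g y))
    ≡⟨ ∑-cong (allFin n) (λ x → trans (∑-cong (allFin n) (λ y → complement (x ≟ y) (g x * g y)))
         (trans (∑-minus (allFin n) (λ y → g x * g y) (λ y → ind (x ≟ y) * (g x * g y)))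
         (cong₂ _-_ (∑-* (allFin n) (g x) g) (diagonal x)))) ⟩
  ∑ᶠ (λ x → g x * ∑ᶠ g - g x * g x)
    ≡⟨ ∑-minus (allFin n) (λ x → g x * ∑ᶠ g) (λ x → g x * g x) ⟩
  ∑ᶠ (λ x → g x * ∑ᶠ g) - ∑ᶠ (λ x → g x * g x)
    ≡⟨ cong (_- ∑ᶠ (λ x → g x * g x)) (trans (∑-cong (allFin n) (λ x → *-comm (g x) (∑ᶠ g))) (∑-* (allFin n) (∑ᶠ g) g)) ⟩
  ∑ᶠ g * ∑ᶠ g - ∑ᶠ (λ x → g x * g x) ∎)
  where
  open ≡-Reasoning
  complement : ∀ {X : Set} (d : Dec X) t → ind (¬? d) * t ≡ t - ind d * t
  complement (yes _) t = sym (trans (cong (_-_ t) (*-identityˡ t)) (+-inverseʳ t))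
  complement (no _) t = trans (*-identityˡ t) (sym (+-identityʳ t))
  diagonal : ∀ x → ∑ᶠ (λ y → ind (x ≟ y) * (g x * g y)) ≡ g x * g x
  diagonal x = trans (∑ᶠ-point (λ y → ind (x ≟ y) * (g x * g y)) x
      (λ y y≢x → cong (_* (g x * g y)) (ind-no (x ≟ y) (y≢x ∘ sym))))
    (trans (cong (_* (g x * g x)) (ind-yes (x ≟ x) refl)) (*-identityˡ _))

length-distinctPairs : ∀ n → + length (distinctPairs n) ≡ + n * + n - + n
length-distinctPairs n = begin
  + length (distinctPairs n)            ≡⟨ *-identityʳ _ ⟨
  + length (distinctPairs n) * 1ℤ       ≡⟨ ∑-const (distinctPairs n) 1ℤ ⟨
  ∑ (distinctPairs n) (λ _ → 1ℤ)        ≡⟨ ∑-distinctPairs-product {n} (λ _ → 1ℤ) ⟩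
  ∑ᶠ {n} (λ _ → 1ℤ) * ∑ᶠ {n} (λ _ → 1ℤ) - ∑ᶠ {n} (λ _ → 1ℤ)
    ≡⟨ cong (λ m → m * m - m) (trans (∑ᶠ-const {n} 1ℤ) (*-identityʳ (+ n))) ⟩
  + n * + n - + n ∎
  where open ≡-Reasoning

module _ {v : ℕ} {D : List (Subset v)} where
  open DecMembership (Vec.≡-dec {n = v} Bool._≟_) renaming (_∈?_ to _∈ᴸ?_) using ()

  tri-swap : ∀ (z x y : Fin v) → tri z x y ≡ tri z y x
  tri-swap z x y = cong (⁅ z ⁆ ∪_) (∪-comm ⁅ x ⁆ ⁅ y ⁆)

  tri-rotate : ∀ (x y z : Fin v) → tri x y z ≡ tri z x y
  tri-rotate x y z = trans (sym (∪-assoc ⁅ x ⁆ ⁅ y ⁆ ⁅ z ⁆)) (∪-comm (⁅ x ⁆ ∪ ⁅ y ⁆) ⁅ z ⁆)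

  free : Fin v → Fin v → Fin v → ℤ
  free z x y = ind (Free? {D = D} z x y)

  freeDegree : Fin v × Fin v → ℤ
  freeDegree (x , y) = ∑ᶠ (λ z → free z x y)

  pairTotal : List (Subset v) → Fin v × Fin v → ℤ
  pairTotal L (x , y) = + pairCount x y L

  Link? : ∀ z w x y → Dec (Link {D = D} z w x y)
  Link? z w x y = Free? z x y ×-dec Free? w x y

  Link-sym : ∀ {z w x y} → Link {D = D} z w x y → Link {D = D} z w y x
  Link-sym (f , g) = flip f , flip g
    where
    flip : ∀ {z x y} → Free {D = D} z x y → Free {D = D} z y x
    flip {z} {x} {y} ((z≢x , z≢y , x≢y) , ∉D) = (z≢y , z≢x , x≢y ∘ sym) , ∉D ∘ subst (_∈ D) (tri-swap z y x)

  -- Each of the `v - 2` third points gives a free triple or a block of `D` through `x` and `y`, and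
  -- different points give different blocks.
  degree-bound : ∀ {x y} → x ≢ y → + v - + 2 ≤ freeDegree (x , y) + pairTotal D (x , y)
  degree-bound {x} {y} x≢y = begin
    + v - + 2
      ≡⟨ cong (λ k → + k - + 2) (length-others x≢y) ⟨
    + (2 ℕ.+ length (others x y)) - + 2
      ≡⟨ cancel (+ length (others x y)) ⟩
    + length (others x y)
      ≡⟨ length-filter≡∑ other? (allFin v) ⟩
    ∑ᶠ (λ z → ind (other? z))
      ≤⟨ ∑-mono (allFin v) (λ z → classify z (other? z) (tri z x y ∈ᴸ? D)) ⟩
    ∑ᶠ (λ z → free z x y + ind (blocked? z))
      ≡⟨ ∑-+ (allFin v) (λ z → free z x y) (λ z → ind (blocked? z)) ⟩
    freeDegree (x , y) + ∑ᶠ (λ z → ind (blocked? z))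
      ≡⟨ cong (_+_ (freeDegree (x , y))) (length-filter≡∑ blocked? (allFin v)) ⟨
    freeDegree (x , y) + + length (filter blocked? (allFin v))
      ≤⟨ +-monoʳ-≤ (freeDegree (x , y)) (+≤+ blocked≤pairs) ⟩
    freeDegree (x , y) + pairTotal D (x , y) ∎
    where
    open ≤-Reasoning
    other? : ∀ z → Dec (z ≢ x × z ≢ y)
    other? z = ¬? (z ≟ x) ×-dec ¬? (z ≟ y)
    blocked? : ∀ z → Dec ((z ≢ x × z ≢ y) × tri z x y ∈ D)
    blocked? z = other? z ×-dec (tri z x y ∈ᴸ? D)
    cancel : ∀ l → + 2 + l - + 2 ≡ l
    cancel = solve-∀
    classify : ∀ z (o : Dec (z ≢ x × z ≢ y)) → Dec (tri z x y ∈ D) → ind o ≤ free z x y + ind (blocked? z)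
    classify z (no _) _ = +-mono-≤ (0≤ind (Free? {D = D} z x y)) (0≤ind (blocked? z))
    classify z (yes o) (yes ∈D) = +-mono-≤ (0≤ind (Free? {D = D} z x y)) (≤-reflexive (sym (ind-yes (blocked? z) (o , ∈D))))
    classify z (yes (z≢x , z≢y)) (no ∉D) = +-mono-≤ {1ℤ}
      (≤-reflexive (sym (ind-yes (Free? z x y) ((z≢x , z≢y , x≢y) , ∉D)))) (0≤ind (blocked? z))
    blocked⁻ : ∀ {z} → z ∈ filter blocked? (allFin v) → (z ≢ x × z ≢ y) × tri z x y ∈ D
    blocked⁻ = proj₂ ∘ ∈-filter⁻ blocked? {xs = allFin v}
    blocked≤pairs : length (filter blocked? (allFin v)) ℕ.≤ pairCount x y D
    blocked≤pairs = subst (ℕ._≤ pairCount x y D) (length-map (tri x y) (filter blocked? (allFin v))) (Unique-⊆⇒length-≤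
      (AllPairs.map⁺ (AllPairs.map (λ (z≢z′ , ((z≢x , z≢y) , _) , _) e → z≢z′ (tri-injective z≢x z≢y e))
        (AllPairs-withAll (Unique.filter⁺ blocked? (Unique.allFin⁺ v)) (All.tabulate blocked⁻))))
      mem)
      where
      mem : ∀ {B} → B ∈ map (tri x y) (filter blocked? (allFin v)) → B ∈ filter (λ B → (x ∈? B) ×-dec (y ∈? B)) D
      mem B∈ with ∈-map⁻ (tri x y) B∈
      ... | z , z∈ , refl = ∈-filter⁺ (λ B → (x ∈? B) ×-dec (y ∈? B))
        (subst (_∈ D) (sym (tri-rotate x y z)) (proj₂ (blocked⁻ z∈)))
        (∈-tri⁺ (here refl) , ∈-tri⁺ (there (here refl)))

  -- A triple contains 3 * 3 - 3 ordered pairs, whence the factor 6.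
  pairTotal-sum : All (λ B → ∣ B ∣ ≡ 3) D → ∑ (distinctPairs v) (pairTotal D) ≡ + length D * + 6
  pairTotal-sum triples = begin
    ∑ (distinctPairs v) (pairTotal D)
      ≡⟨ ∑-cong (distinctPairs v) (λ (x , y) → +pairCount x y D) ⟩
    ∑ (distinctPairs v) (λ (x , y) → ∑ D (pairInd x y))
      ≡⟨ ∑-swap (distinctPairs v) D (λ (x , y) → pairInd x y) ⟩
    ∑ D (λ B → ∑ (distinctPairs v) (λ (x , y) → pairInd x y B))
      ≡⟨ ∑-cong-∈ D (λ B B∈ → trans (∑-distinctPairs-product (λ x → ind (x ∈? B)))
           (trans (cong₂ (λ s t → s * s - t) (sym (card≡∑ B))
             (trans (∑-cong (allFin v) (λ x → ind-idem (x ∈? B))) (sym (card≡∑ B))))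
           (cong (λ k → + k * + k - + k) (All.lookup triples B∈)))) ⟩
    ∑ D (λ _ → + 6)
      ≡⟨ ∑-const D (+ 6) ⟩
    + length D * + 6 ∎
    where open ≡-Reasoning

  module _ (defining : IsDefiningSet v 3 D) (3≤v : 3 ℕ.≤ v) where

    -- `3 ≤ v` supplies the third vertex `t`. In the link `z` and `w` are isolated because the
    -- points of a free triple are distinct.
    link-bound : ∀ {z w} → z ≢ w → + 3 * ∑ᶠ (λ x → ∑ᶠ λ y → ind (Link? z w x y)) + + 22 ≤ + 8 * + v
    link-bound {z} {w} z≢w with others z w | length-others z≢w | (λ {t} → ∈-others⁻ {z = t} {z} {w})
    ... | [] | refl | _ = contradiction 3≤v λ { (ℕ.s≤s (ℕ.s≤s ())) }
    ... | t ∷ _ | _ | other = edge-bound (Link? z w) Link-sym (proj₂ ∘ proj₂ ∘ proj₁ ∘ proj₁)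
      (forest (Link? z w) Link-sym) (link-no-circuit defining z≢w) z≢w
      (λ (((z≢z , _) , _) , _) → z≢z refl) (λ (_ , ((w≢w , _) , _)) → w≢w refl)
      (proj₁ (other (here refl))) (proj₂ (other (here refl)))

    -- Both sides count configurations of a pair `x y` and a pair `z w` with both triples free:
    -- grouped by `x y` they number d(d - 1), grouped by `z w` they are the edges of the link.
    second-moment : ∑ (distinctPairs v) (λ e → freeDegree e * freeDegree e) - ∑ (distinctPairs v) freeDegree
      ≤ ∑ (distinctPairs v) (λ (z , w) → ∑ᶠ (λ x → ∑ᶠ λ y → ind (Link? z w x y)))
    second-moment = begin
      ∑ pairs (λ e → freeDegree e * freeDegree e) - ∑ pairs freeDegree
        ≡⟨ ∑-minus pairs (λ e → freeDegree e * freeDegree e) freeDegree ⟨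
      ∑ pairs (λ e → freeDegree e * freeDegree e - freeDegree e)
        ≡⟨ ∑-cong pairs (λ (x , y) → sym (trans (∑-distinctPairs-product (λ z → free z x y))
             (cong (_-_ (freeDegree (x , y) * freeDegree (x , y))) (∑-cong (allFin v) (λ z → ind-idem (Free? {D = D} z x y)))))) ⟩
      ∑ pairs (λ (x , y) → ∑ pairs (λ (z , w) → free z x y * free w x y))
        ≡⟨ ∑-swap pairs pairs (λ (x , y) (z , w) → free z x y * free w x y) ⟩
      ∑ pairs (λ (z , w) → ∑ pairs (λ (x , y) → free z x y * free w x y))
        ≡⟨ ∑-cong pairs (λ (z , w) → trans (∑-cong pairs (λ (x , y) → sym (ind-× (Free? {D = D} z x y) (Free? w x y))))
             (∑-distinctPairs (λ (x , y) → ind (Link? z w x y)))) ⟩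
      ∑ pairs (λ (z , w) → ∑ᶠ (λ x → ∑ᶠ λ y → ind (¬? (x ≟ y)) * ind (Link? z w x y)))
        ≤⟨ ∑-mono pairs (λ (z , w) → ∑-mono (allFin v) (λ x → ∑-mono (allFin v) (λ y → drop (¬? (x ≟ y)) (Link? z w x y)))) ⟩
      ∑ pairs (λ (z , w) → ∑ᶠ (λ x → ∑ᶠ λ y → ind (Link? z w x y))) ∎
      where
      open ≤-Reasoning
      pairs = distinctPairs v
      drop : ∀ {X Y : Set} (d : Dec X) (e : Dec Y) → ind d * ind e ≤ ind e
      drop (yes _) e = ≤-reflexive (*-identityˡ (ind e))
      drop (no _) e = 0≤ind e

    second-moment-bound : + 3 * (∑ (distinctPairs v) (λ e → freeDegree e * freeDegree e) - ∑ (distinctPairs v) freeDegree)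
      ≤ + length (distinctPairs v) * (+ 8 * + v - + 22)
    second-moment-bound = begin
      + 3 * (∑ (distinctPairs v) (λ e → freeDegree e * freeDegree e) - ∑ (distinctPairs v) freeDegree)
        ≤⟨ *-monoˡ-≤-nonNeg (+ 3) second-moment ⟩
      + 3 * ∑ (distinctPairs v) linkSize
        ≡⟨ ∑-* (distinctPairs v) (+ 3) linkSize ⟨
      ∑ (distinctPairs v) (λ e → + 3 * linkSize e)
        ≤⟨ ∑-mono-∈ (distinctPairs v) (λ e e∈ → subst (_≤ + 8 * + v - + 22) (cancel (+ 3 * linkSize e))
             (+-monoˡ-≤ (- + 22) (link-bound (∈-distinctPairs⁻ e∈)))) ⟩
      ∑ (distinctPairs v) (λ _ → + 8 * + v - + 22)
        ≡⟨ ∑-const (distinctPairs v) (+ 8 * + v - + 22) ⟩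
      + length (distinctPairs v) * (+ 8 * + v - + 22) ∎
      where
      open ≤-Reasoning
      linkSize : Fin v × Fin v → ℤ
      linkSize (z , w) = ∑ᶠ (λ x → ∑ᶠ λ y → ind (Link? z w x y))
      cancel : ∀ a → a + + 22 - + 22 ≡ a
      cancel = solve-∀

    first-moment-bound : + length (distinctPairs v) * (+ v - + 2) - + 6 * + length D ≤ ∑ (distinctPairs v) freeDegree
    first-moment-bound = begin
      + length (distinctPairs v) * (+ v - + 2) - + 6 * + length D
        ≡⟨ cong (_- + 6 * + length D) (∑-const (distinctPairs v) (+ v - + 2)) ⟨
      ∑ (distinctPairs v) (λ _ → + v - + 2) - + 6 * + length D
        ≤⟨ +-monoˡ-≤ (- (+ 6 * + length D)) (∑-mono-∈ (distinctPairs v) (λ e e∈ → degree-bound (∈-distinctPairs⁻ e∈))) ⟩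
      ∑ (distinctPairs v) (λ e → freeDegree e + pairTotal D e) - + 6 * + length D
        ≡⟨ cong (_- + 6 * + length D) (trans (∑-+ (distinctPairs v) freeDegree (pairTotal D))
             (cong (_+_ (∑ (distinctPairs v) freeDegree)) (pairTotal-sum (proj₂ (proj₁ defining))))) ⟩
      ∑ (distinctPairs v) freeDegree + + length D * + 6 - + 6 * + length D
        ≡⟨ cancel (∑ (distinctPairs v) freeDegree) (+ length D) ⟩
      ∑ (distinctPairs v) freeDegree ∎
      where
      open ≤-Reasoning
      cancel : ∀ s d → s + d * + 6 - + 6 * d ≡ s
      cancel = solve-∀

-- Completing the square: Cauchy-Schwarz and the second moment bound `s * s - k * s`, so the square
-- of `6 s - 3 k` is bounded, with 96 = 12 * 8 and 255 = 12 * 22 - 9. By the first moment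
-- `6 s - 3 k` is at least the left side of the conclusion.
moments⇒bound : ∀ k V d s Q → + k ≡ V * V - V → + k * (V - + 2) - + 6 * d ≤ s →
  s * s ≤ + k * Q → + 3 * (Q - s) ≤ + k * (+ 8 * V - + 22) →
  (+ 3 * V * (V - + 1) * (+ 2 * V - + 5) - + 36 * d) ≤ (V * (V - + 1)) ·√ (+ 96 * V - + 255)
moments⇒bound k V d s Q k≡ first cs second with ≤-total (+ 3 * V * (V - + 1) * (+ 2 * V - + 5) - + 36 * d) 0ℤ
... | inj₁ x≤0 = inj₁ x≤0
... | inj₂ 0≤x = inj₂ (begin
  x * x
    ≤⟨ *-monoˡ-≤-nonNeg x {{nonNegative 0≤x}} x≤y ⟩
  x * y
    ≤⟨ *-monoʳ-≤-nonNeg y {{nonNegative (≤-trans 0≤x x≤y)}} x≤y ⟩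
  y * y
    ≡⟨ expand s (+ k) ⟩
  + 36 * (s * s) + (+ 9 * (+ k * + k) - + 36 * (+ k * s))
    ≤⟨ +-monoˡ-≤ (+ 9 * (+ k * + k) - + 36 * (+ k * s)) (*-monoˡ-≤-nonNeg (+ 36) cs) ⟩
  + 36 * (+ k * Q) + (+ 9 * (+ k * + k) - + 36 * (+ k * s))
    ≡⟨ regroup s (+ k) Q ⟩
  + 12 * (+ k * (+ 3 * (Q - s))) + + 9 * (+ k * + k)
    ≤⟨ +-monoˡ-≤ (+ 9 * (+ k * + k)) (*-monoˡ-≤-nonNeg (+ 12) (*-monoˡ-≤-nonNeg (+ k) second)) ⟩
  + 12 * (+ k * (+ k * (+ 8 * V - + 22))) + + 9 * (+ k * + k)
    ≡⟨ collect (+ k) V ⟩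
  + k * + k * (+ 96 * V - + 255)
    ≡⟨ cong (λ c → c * c * (+ 96 * V - + 255)) (trans k≡ (factor V)) ⟩
  V * (V - + 1) * (V * (V - + 1)) * (+ 96 * V - + 255) ∎)
  where
  open ≤-Reasoning
  x = + 3 * V * (V - + 1) * (+ 2 * V - + 5) - + 36 * d
  y = + 6 * s - + 3 * + k
  x≡ : ∀ V d → + 3 * V * (V - + 1) * (+ 2 * V - + 5) - + 36 * d ≡
    + 6 * ((V * V - V) * (V - + 2) - + 6 * d) - + 3 * (V * V - V)
  x≡ = solve-∀
  x≤y : x ≤ y
  x≤y = begin
    x                                                       ≡⟨ x≡ V d ⟩
    + 6 * ((V * V - V) * (V - + 2) - + 6 * d) - + 3 * (V * V - V)
      ≡⟨ cong (λ c → + 6 * (c * (V - + 2) - + 6 * d) - + 3 * c) k≡ ⟨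
    + 6 * (+ k * (V - + 2) - + 6 * d) - + 3 * + k
      ≤⟨ +-monoˡ-≤ (- (+ 3 * + k)) (*-monoˡ-≤-nonNeg (+ 6) first) ⟩
    y ∎
  expand : ∀ s k → (+ 6 * s - + 3 * k) * (+ 6 * s - + 3 * k) ≡ + 36 * (s * s) + (+ 9 * (k * k) - + 36 * (k * s))
  expand = solve-∀
  regroup : ∀ s k Q → + 36 * (k * Q) + (+ 9 * (k * k) - + 36 * (k * s)) ≡ + 12 * (k * (+ 3 * (Q - s))) + + 9 * (k * k)
  regroup = solve-∀
  collect : ∀ k V → + 12 * (k * (k * (+ 8 * V - + 22))) + + 9 * (k * k) ≡ k * k * (+ 96 * V - + 255)
  collect = solve-∀
  factor : ∀ V → V * V - V ≡ V * (V - + 1)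
  factor = solve-∀

-- The inequality is multiplied by 36 to clear denominators; the factor 6 left before the root goes
-- under it and gives 36 (32 v - 85) / 12 = 96 v - 255.
theorem3p3 : (v : ℕ) → 3 ℕ.≤ v → (D : List (Subset v)) → IsDefiningSet v 3 D →
    ((+ 3) * (+ v) * (+ v - + 1) * ((+ 2) * (+ v) - + 5) - (+ 36) * (+ length D))
    ≤ ((+ v) * (+ v - + 1)) ·√ ((+ 96) * (+ v) - + 255)
theorem3p3 v 3≤v D defining = moments⇒bound (length (distinctPairs v)) (+ v) (+ length D)
  (∑ (distinctPairs v) freeDegree) (∑ (distinctPairs v) (λ e → freeDegree e * freeDegree e))
  (length-distinctPairs v) (first-moment-bound defining 3≤v)
  (cauchy-schwarz (distinctPairs v) freeDegree) (second-moment-bound defining 3≤v)
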